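{- The online algorithm $\texttt{Alg}_1^*$ (described in the context) has competitive ratio $O(\log^2 r)$ for the online problem of packing disjoint bases of a polymatroid $f$ with $r=f(\mathcal{N})$: there is an absolute constant $C_0$ such that for every polymatroid $f$ with $f(\{e\})>0$ for all $e\in\mathcal{N}$ and every arrival order, $\mathbb{E}[\texttt{Alg}_1^*(f)]\ge\texttt{opt}(f)/(C_0\max\{1,\log^2 r\})$.
   Context: A polymatroid $f:2^{\mathcal{N}}\to\mathbb{Z}_{\ge0}$ is integer-valued, monotone, submodular with $f(\emptyset)=0$; $S$ is a base if $f(S)=f(\mathcal{N})$; $\texttt{opt}(f)$ is the maximum number of pairwise disjoint bases. Elements arrive online in order $e_1,\dots,e_n$; $\mathcal{N}_t=\{e_1,\dots,e_t\}$; the algorithm knows $r=f(\mathcal{N})$ and at time $t$ may query $f$ on subsets of $\mathcal{N}_t$, and must irrevocably color $e_t$. A color is a base color if its elements form a base; $\texttt{Alg}(f)$ is the number of base colors. A set $Q\subseteq\mathcal{V}$ is a quotient of a polymatroid $g$ on $\mathcal{V}$ if $g((\mathcal{V}\setminus Q)\cup\{e\})>g(\mathcal{V}\setminus Q)$ for all $e\in Q$. Algorithm 1: for each $t$, compute $q_t=\min\{|Q|: e_t\in Q\subseteq\mathcal{N}_t,\ Q\text{ a quotient of }f_{|\mathcal{N}_t}\}$, set $\ell_t=\lceil\log q_t\rceil$, sample an integer $R_t$ uniformly from $[\ell_t-3\lceil\log r\rceil,\ell_t+3\lceil\log r\rceil]$, and set $C(e_t)$ uniformly from $\{1,\dots,\lfloor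 2^{R_t}/(60\log^2 r)\rfloor\}$. $\texttt{Alg}_1^*$: with probability $1/3$ run Algorithm 1; with probability $1/3$ set $C(e_t)=1$ for all $t$; with probability $1/3$ set $C(e_t)=t$ for all $t$. Logarithms are base 2. -}

module Defs where

open import Data.Nat as ℕ using (ℕ; zero; suc; _+_; _*_; _^_; _≤_; _<_; _⊔_; _≡ᵇ_; _≤ᵇ_)
open import Data.Nat.Logarithm using (⌈log₂_⌉)
open import Data.Integer as ℤ using (ℤ; +_; -[1+_])
open import Data.Rational as ℚ using (ℚ; 0ℚ)
open import Data.Fin using (Fin; toℕ)
open import Data.Fin.Subset using (Subset; _∪_; _∩_; ∁; ⁅_⁆; _⊆_; _∈_; ∣_∣; ⊥; ⊤)
open import Data.Vec using (tabulate)
open import Data.Vec.Functional as VF using (Vector)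
open import Data.List as List using (List; []; _∷_; map; upTo; filter; length; concatMap; foldr)
open import Data.Product using (Σ; ∃; _×_; _,_)
open import Data.Sum using (_⊎_)
open import Relation.Nullary using (¬_)
open import Relation.Binary.PropositionalEquality using (_≡_; _≢_)
open import Function using (_∘_)

-- Ground set 𝒩 = {e_1,…,e_n} is Fin n, indexed in ARRIVAL ORDER:
-- the element i : Fin n is e_{toℕ i + 1}.  Subsets are Subset n.

record IsPolymatroid {n : ℕ} (f : Subset n → ℕ) : Set where
  field
    normalized : f ⊥ ≡ 0
    monotone   : ∀ A B → A ⊆ B → f A ≤ f B
    submodular : ∀ A B → f (A ∪ B) + f (A ∩ B) ≤ f A + f B

rank : {n : ℕ} → (Subset n → ℕ) → ℕ
rank f = f ⊤

IsBase : {n : ℕ} → (Subset n → ℕ) → Subset n → Set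
IsBase f S = f S ≡ f ⊤

PairwiseDisjoint : {n k : ℕ} → (Fin k → Subset n) → Set
PairwiseDisjoint B = ∀ i j → i ≢ j → B i ∩ B j ≡ ⊥

IsOpt : {n : ℕ} → (Subset n → ℕ) → ℕ → Set
IsOpt {n} f o =
  (Σ (Fin o → Subset n) λ B → PairwiseDisjoint B × (∀ i → IsBase f (B i)))
  × (∀ k (B : Fin k → Subset n) → PairwiseDisjoint B → (∀ i → IsBase f (B i)) → k ≤ o)

prefix : {n : ℕ} → Fin n → Subset n
prefix i = tabulate (λ j → toℕ j ≤ᵇ toℕ i)

IsQuotientOn : {n : ℕ} → (Subset n → ℕ) → Subset n → Subset n → Set
IsQuotientOn f V Q = Q ⊆ V × (∀ e → e ∈ Q → f (V ∩ ∁ Q) < f ((V ∩ ∁ Q) ∪ ⁅ e ⁆))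

IsMinQuotientSize : {n : ℕ} → (Subset n → ℕ) → Fin n → ℕ → Set
IsMinQuotientSize f i q =
  (Σ _ λ Q → IsQuotientOn f (prefix i) Q × i ∈ Q × ∣ Q ∣ ≡ q)
  × (∀ Q → IsQuotientOn f (prefix i) Q → i ∈ Q → q ≤ ∣ Q ∣)

-- Real-number comparisons involving L = log₂ r, expressed exactly via
-- rationals a/(suc b) (Dedekind-cut style).  Note a/(1+b) ≤ L ⇔ 2^a ≤ r^(1+b)
-- and a/(1+b) ≥ L ⇔ r^(1+b) ≤ 2^a.

-- Over r R m  ⇔  60 · m · (log₂ r)² > 2^R   (R ∈ ℤ)
Over : ℕ → ℤ → ℕ → Set
Over r (+ k) m =
  ∃ λ a → ∃ λ b → 2 ^ a ≤ r ^ suc b × 2 ^ k * (suc b * suc b) < 60 * m * (a * a)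
Over r -[1+ k ] m =
  ∃ λ a → ∃ λ b → 2 ^ a ≤ r ^ suc b × suc b * suc b < 60 * m * (a * a) * 2 ^ suc k

-- m = ⌊ 2^R / (60 log² r) ⌋  (for r ≥ 2; convention m = 1 for r ≤ 1, where
-- the formula divides by zero)
PaletteSize : ℕ → ℤ → ℕ → Set
PaletteSize r R m =
  (r ≤ 1 × m ≡ 1) ⊎ (2 ≤ r × ¬ Over r R m × Over r R (suc m))

Coloring : ℕ → Set
Coloring n = Vector ℕ n

colorClass : {n : ℕ} → Coloring n → ℕ → Subset n
colorClass C c = tabulate (λ i → C i ≡ᵇ c)

maxColor : {n : ℕ} → Coloring n → ℕ
maxColor C = VF.foldr _⊔_ 0 C

-- Alg: number of colors c ∈ {1,…,max} whose class is a base
-- (color 0 is used for discarded elements and is never a color)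
numBaseColors : {n : ℕ} → (Subset n → ℕ) → Coloring n → ℕ
numBaseColors f C =
  length (filter (λ c → f (colorClass C c) ℕ.≟ f ⊤) (map suc (upTo (maxColor C))))

Dist : Set
Dist = List (ℚ × ℕ)

sumℚ : List ℚ → ℚ
sumℚ = foldr ℚ._+_ 0ℚ

expect : {n : ℕ} → (Fin n → Dist) → (Coloring n → ℚ) → ℚ
expect {zero} ds g = g (λ ())
expect {suc n} ds g =
  sumℚ (map (λ { (w , c) → w ℚ.* expect (ds ∘ Fin.suc) (λ C → g (c VF.∷ C)) }) (ds Fin.zero))
  where import Data.Fin as Fin

ℕtoℚ : ℕ → ℚ
ℕtoℚ k = + k ℚ./ 1

-- Law of C(e_t) in Algorithm 1 (r = f(𝒩), qt = q_t, K R = palette size):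
-- R_t = ℓ_t - 3⌈log r⌉ + j, j uniform in {0,…,6⌈log r⌉};
-- C(e_t) uniform in {1,…,K R_t}; if K R_t = 0 the element is discarded (color 0).
alg1Law : ℕ → (ℤ → ℕ) → ℕ → Dist
alg1Law r K qt = concatMap perR (upTo (suc (6 * c)))
  where
  c = ⌈log₂ r ⌉
  ℓ = ⌈log₂ qt ⌉
  s = suc (6 * c)
  perR : ℕ → Dist
  perR j with K ((+ (ℓ + j)) ℤ.- (+ (3 * c)))
  ... | zero  = (+ 1 ℚ./ s , 0) ∷ []
  ... | suc m = map (λ col → (+ 1 ℚ./ (s * suc m) , suc col)) (upTo (suc m))

-- E[Alg*_1(f)] given the (uniquely determined) q_t's and palette sizes
expectedAlgStar : {n : ℕ} → (Subset n → ℕ) → (Fin n → ℕ) → (ℤ → ℕ) → ℚ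
expectedAlgStar {n} f q K =
  (+ 1 ℚ./ 3) ℚ.* expect (λ i → alg1Law (f ⊤) K (q i)) (λ C → ℕtoℚ (numBaseColors f C))
  ℚ.+ (+ 1 ℚ./ 3) ℚ.* ℕtoℚ (numBaseColors f (λ _ → 1))
  ℚ.+ (+ 1 ℚ./ 3) ℚ.* ℕtoℚ (numBaseColors f (λ i → suc (toℕ i)))

-- o ≤ C0 · max{1, (log₂ r)²} · E   (exact, via rationals x = a/(1+b) ≥ log₂ r)
RatioBound : ℕ → ℕ → ℕ → ℚ → Set
RatioBound C0 r o E =
  (ℕtoℚ o ℚ.≤ ℕtoℚ C0 ℚ.* E)
  ⊎ ¬ (∃ λ a → ∃ λ b → r ^ suc b ≤ 2 ^ a
         × ℕtoℚ C0 ℚ.* E ℚ.* ((+ a ℚ./ suc b) ℚ.* (+ a ℚ./ suc b)) ℚ.< ℕtoℚ o)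

{-# OPTIONS --safe #-}
module Submission where

-- Let c = ⌈log₂ r⌉, let o be the optimum and 2^R ≈ o. Call e_t small when ⌈log q_t⌉ + 3c < R, and
-- let its level be the larger of R and ⌈log q_t⌉ − 3c. A non-small element guesses R_t = level
-- with probability 1/(6c+1), so it receives any fixed color within the palette of 2^R with
-- probability at least (c+1)/2^level. Fix such a color and a set A, and let Q be the quotient of
-- elements that increase f(A).
--   * If all levels in Q equal R, the o disjoint bases give Q total marginal at least
--     o·(r − f(A)), of which small elements account for a minority: at most m·r elements have
--     q_t ≤ m, because removing a minimum quotient of the last of them lowers the rank.
--   * Otherwise let e_t ∈ Q have the maximal level R' > R. The part of Q in 𝒩_t is a quotient, so
--     |Q| ≥ q_t, which exceeds 2^R'·r by a constant factor; all these marginals are at least 1.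
-- Either way Σ_e 2^(−level e) · (f(A ∪ e) − f(A)) ≥ r − f(A), summed over the non-small e. Splitting
-- the class of the color into c+1 rounds with these rates, concavity of the multilinear extension
-- halves the expected deficit in each round, so the class is a base with probability at least 1/2.
-- Palettes with a bounded number of colors are covered by the constant coloring, and rank 1 by
-- the coloring with all colors distinct.

open import Defs

-- Marginals and quotients of a polymatroid.

module Quotients where
  open import Data.Nat
  open import Data.Nat.Properties
  open import Data.Nat.Solver using (module +-*-Solver)
  open import Data.Bool using (Bool; true; false; if_then_else_; not)
  open import Data.Bool.Properties using (∨-zeroʳ; ∨-identityʳ; T-≡)
  open import Data.Fin using (Fin; zero; suc; toℕ)
  import Data.Fin.Properties as FinP
  open import Data.Fin.Subset using (Subset; inside; outside; _⊆_; _∈_; _∪_; _∩_; ∁; ⁅_⁆; ∣_∣; ⊥; ⊤)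
  open import Data.Fin.Subset.Properties
  open import Data.Vec using ([]; _∷_; _[_]≔_; lookup; tabulate; here; there)
  open import Data.Vec.Properties using (lookup⇒[]=; []=⇒lookup; lookup∘tabulate)
  open import Data.Product using (∃; _×_; _,_; proj₁; proj₂)
  open import Data.Sum using (_⊎_; inj₁; inj₂; map₂)
  open import Function using (_∘_)
  open import Function.Bundles using (Equivalence)
  open import Relation.Nullary using (contradiction; yes; no)
  open import Relation.Binary.PropositionalEquality using (_≡_; refl; sym; trans; cong; cong₂; subst)
  open import Algebra.Properties.CommutativeMonoid.Sum +-0-commutativeMonoid using (sum; ∑-comm; ∑-distrib-+; sum-cong-≗; sum-replicate-zero)
  open import Algebra.Properties.Semiring.Sum +-*-semiring using (*-distribʳ-sum)

  insert : ∀ {n} → Fin n → Subset n → Subset n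
  insert e A = A [ e ]≔ inside

  sum-mono : ∀ {n} {g h : Fin n → ℕ} → (∀ i → g i ≤ h i) → sum g ≤ sum h
  sum-mono {zero} le = ≤-refl
  sum-mono {suc n} le = +-mono-≤ (le zero) (sum-mono (le ∘ suc))

  sum-zero : ∀ {n} {g : Fin n → ℕ} → (∀ i → g i ≡ 0) → sum g ≡ 0
  sum-zero {n} g≡0 = trans (sum-cong-≗ g≡0) (sum-replicate-zero n)

  sum-const : ∀ n a → sum {n} (λ _ → a) ≡ n * a
  sum-const zero a = refl
  sum-const (suc n) a = cong (a +_) (sum-const n a)

  when : Bool → ℕ → ℕ
  when b x = if b then x else 0

  when-≤ : ∀ b x → when b x ≤ x
  when-≤ true x = ≤-refl
  when-≤ false x = z≤n

  -- Serves `bases-bound`: an element lies in at most one of the disjoint bases, so its marginal is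
  -- counted at most once.
  sum-when-unique : ∀ {k} (b : Fin k → Bool) x → (∀ i j → b i ≡ true → b j ≡ true → i ≡ j) → sum (λ i → when (b i) x) ≤ x
  sum-when-unique {zero} b x uniq = z≤n
  sum-when-unique {suc k} b x uniq with b zero in eq
  ... | false = sum-when-unique (b ∘ suc) x (λ i j p q → FinP.suc-injective (uniq (suc i) (suc j) p q))
  ... | true = ≤-reflexive (trans (cong (x +_) (sum-zero tail-zero)) (+-identityʳ x))
    where
    tail-zero : ∀ i → when (b (suc i)) x ≡ 0
    tail-zero i with b (suc i) in eq'
    ... | false = refl
    ... | true with uniq zero (suc i) eq eq'
    ... | ()

  ∣∣-sum : ∀ {n} (A : Subset n) → ∣ A ∣ ≡ sum (λ e → when (lookup A e) 1)
  ∣∣-sum [] = refl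
  ∣∣-sum (true ∷ A) = cong suc (∣∣-sum A)
  ∣∣-sum (false ∷ A) = ∣∣-sum A

  ∣∣-split : ∀ {n} (V Q : Subset n) → ∣ V ∣ ≤ ∣ V ∩ ∁ Q ∣ + ∣ Q ∣
  ∣∣-split [] [] = z≤n
  ∣∣-split (true ∷ V) (true ∷ Q) = ≤-trans (s≤s (∣∣-split V Q)) (≤-reflexive (sym (+-suc _ _)))
  ∣∣-split (true ∷ V) (false ∷ Q) = s≤s (∣∣-split V Q)
  ∣∣-split (false ∷ V) (true ∷ Q) = ≤-trans (∣∣-split V Q) (+-monoʳ-≤ ∣ V ∩ ∁ Q ∣ (n≤1+n _))
  ∣∣-split (false ∷ V) (false ∷ Q) = ∣∣-split V Q

  insert≡∪ : ∀ {n} (e : Fin n) A → insert e A ≡ A ∪ ⁅ e ⁆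
  insert≡∪ zero (a ∷ A) = cong₂ _∷_ (sym (∨-zeroʳ a)) (sym (∪-identityʳ A))
  insert≡∪ (suc e) (a ∷ A) = cong₂ _∷_ (sym (∨-identityʳ a)) (insert≡∪ e A)

  ⊆-insert : ∀ {n} (e : Fin n) (A : Subset n) → A ⊆ insert e A
  ⊆-insert e A = subst (A ⊆_) (sym (insert≡∪ e A)) (p⊆p∪q ⁅ e ⁆)

  ∈-insert : ∀ {n} (e : Fin n) (A : Subset n) → e ∈ insert e A
  ∈-insert zero (a ∷ A) = here
  ∈-insert (suc e) (a ∷ A) = there (∈-insert e A)

  insert-⊆ : ∀ {n} {e : Fin n} {A V} → A ⊆ V → e ∈ V → insert e A ⊆ V
  insert-⊆ {e = e} {A} {V} A⊆V e∈V {x} x∈ with x∈p∪q⁻ A ⁅ e ⁆ (subst (x ∈_) (insert≡∪ e A) x∈)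
  ... | inj₁ x∈A = A⊆V x∈A
  ... | inj₂ x∈e = subst (_∈ V) (sym (x∈⁅y⁆⇒x≡y e x∈e)) e∈V

  ∈-tabulate⁺ : ∀ {n} {b : Fin n → Bool} {e} → b e ≡ true → e ∈ tabulate b
  ∈-tabulate⁺ {b = b} {e} eq = lookup⇒[]= e _ (trans (lookup∘tabulate b e) eq)

  ∈-tabulate⁻ : ∀ {n} {b : Fin n → Bool} {e} → e ∈ tabulate b → b e ≡ true
  ∈-tabulate⁻ {b = b} {e} e∈ = trans (sym (lookup∘tabulate b e)) ([]=⇒lookup e∈)

  ≤ᵇ-true : ∀ {a b} → a ≤ b → (a ≤ᵇ b) ≡ true
  ≤ᵇ-true = Equivalence.to T-≡ ∘ ≤⇒≤ᵇ

  <ᵇ-true : ∀ {a b} → a < b → (a <ᵇ b) ≡ true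
  <ᵇ-true = Equivalence.to T-≡ ∘ <⇒<ᵇ

  <ᵇ-true⁻ : ∀ {a b} → (a <ᵇ b) ≡ true → a < b
  <ᵇ-true⁻ {a} = <ᵇ⇒< a _ ∘ Equivalence.from T-≡

  <ᵇ-false⁻ : ∀ {a b} → (a <ᵇ b) ≡ false → b ≤ a
  <ᵇ-false⁻ {a} {b} eq = ≮⇒≥ λ a<b → contradiction (trans (sym eq) (<ᵇ-true a<b)) λ ()

  -- Diminishing returns.

  marginal : ∀ {n} → (Subset n → ℕ) → Fin n → Subset n → ℕ
  marginal f e A = f (insert e A) ∸ f A

  -- Inductions on the ground set fix the status of the first element. That can destroy `f ⊥ ≡ 0`
  -- but preserves these two conditions. The additive form of `exchange` avoids truncated
  -- subtraction.
  record Diminishing {n} (f : Subset n → ℕ) : Set where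
    field
      increasing : ∀ e A → f A ≤ f (insert e A)
      exchange   : ∀ e {A B} → A ⊆ B → f (insert e B) + f A ≤ f (insert e A) + f B

    marginal-antitone : ∀ e {A B} → A ⊆ B → marginal f e B ≤ marginal f e A
    marginal-antitone e {A} {B} A⊆B = m≤n+o⇒m∸n≤o _ (f B) (+-cancelʳ-≤ (f A) _ _ (begin
      f (insert e B) + f A                    ≤⟨ exchange e A⊆B ⟩
      f (insert e A) + f B                    ≡⟨ cong (_+ f B) (m∸n+n≡m (increasing e A)) ⟨
      marginal f e A + f A + f B              ≡⟨ solve 3 (λ m a b → m :+ a :+ b := b :+ m :+ a) refl (marginal f e A) (f A) (f B) ⟩
      f B + marginal f e A + f A              ∎))
      where
      open ≤-Reasoning
      open +-*-Solver

  open Diminishing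

  cons-diminishing : ∀ {n} {f : Subset (suc n) → ℕ} b → Diminishing f → Diminishing (f ∘ (b ∷_))
  cons-diminishing b d .increasing e A = d .increasing (suc e) (b ∷ A)
  cons-diminishing b d .exchange e A⊆B = d .exchange (suc e) (s⊆s A⊆B)

  -- Induction on the ground set. A first element that lies only in `W` is added to `A` at once; the
  -- remaining marginals are then taken at a larger set, which only makes them smaller. If it
  -- already lies in `A`, its own marginal is 0.
  union-bound : ∀ {n} {f : Subset n → ℕ} → Diminishing f → ∀ A W →
                f (A ∪ W) ≤ f A + sum (λ e → when (lookup W e) (marginal f e A))
  union-bound d [] [] = m≤m+n _ 0
  union-bound {f = f} d (true ∷ A) (w ∷ W) = ≤-trans (union-bound (cons-diminishing true d) A W)
    (+-monoʳ-≤ (f (true ∷ A)) (m≤n+m _ (when w (f (true ∷ A) ∸ f (true ∷ A)))))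
  union-bound d (false ∷ A) (false ∷ W) = union-bound (cons-diminishing false d) A W
  union-bound {f = f} d (false ∷ A) (true ∷ W) = begin
    f (true ∷ (A ∪ W))                          ≤⟨ union-bound (cons-diminishing true d) A W ⟩
    f₁ + sum (λ e → when (lookup W e) (marginal f (suc e) (true ∷ A)))
      ≤⟨ +-monoʳ-≤ f₁ (sum-mono λ e → when-mono (lookup W e) (marginal-antitone d (suc e) (out⊆ ⊆-refl))) ⟩
    f₁ + s                                      ≤⟨ +-monoˡ-≤ s (m≤n+m∸n f₁ f₀) ⟩
    f₀ + (f₁ ∸ f₀) + s                          ≡⟨ +-assoc f₀ (f₁ ∸ f₀) s ⟩
    f₀ + (f₁ ∸ f₀ + s)                          ∎
    where
    open ≤-Reasoning
    f₁ = f (true ∷ A)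
    f₀ = f (false ∷ A)
    s = sum (λ e → when (lookup W e) (marginal f (suc e) (false ∷ A)))
    when-mono : ∀ b {x y} → x ≤ y → when b x ≤ when b y
    when-mono true x≤y = x≤y
    when-mono false x≤y = z≤n

  -- `R` is a floor for the maximum. The final alternative is the case distinction of `progress`:
  -- the bound is the floor itself, or some element attains it strictly above the floor.
  bounded-max : ∀ {n} (b : Fin n → Bool) (g : Fin n → ℕ) R →
    ∃ λ R' → R ≤ R' × (∀ e → b e ≡ true → g e ≤ R') × (R' ≡ R ⊎ ∃ λ t → b t ≡ true × g t ≡ R' × R < R')
  bounded-max {zero} b g R = R , ≤-refl , (λ ()) , inj₁ refl
  bounded-max {suc n} b g R with bounded-max (b ∘ suc) (g ∘ suc) R
  ... | R' , R≤R' , bound , tight with b zero in eq | g zero ≤? R'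
  ... | true | no g≰R' = g zero , <⇒≤ R<g , (λ { zero _ → ≤-refl ; (suc e) p → ≤-trans (bound e p) (<⇒≤ (≰⇒> g≰R')) })
      , inj₂ (zero , eq , refl , R<g)
    where R<g = ≤-<-trans R≤R' (≰⇒> g≰R')
  ... | true | yes g≤R' = R' , R≤R' , (λ { zero _ → g≤R' ; (suc e) p → bound e p }) , map₂ (λ (t , p) → suc t , p) tight
  ... | false | _ = R' , R≤R' , (λ { zero p → contradiction (trans (sym eq) p) λ () ; (suc e) p → bound e p })
      , map₂ (λ (t , p) → suc t , p) tight

  last-element : ∀ {n} (V : Subset n) → V ≡ ⊥ ⊎ ∃ λ t → t ∈ V × (∀ {e} → e ∈ V → toℕ e ≤ toℕ t)
  last-element [] = inj₁ refl
  last-element (a ∷ V) with last-element V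
  ... | inj₂ (t , t∈V , last) = inj₂ (suc t , there t∈V , λ { here → z≤n ; (there e∈V) → s≤s (last e∈V) })
  last-element (true ∷ V) | inj₁ refl = inj₂ (zero , here , λ { here → z≤n ; (there e∈⊥) → contradiction e∈⊥ ∉⊥ })
  last-element (false ∷ V) | inj₁ refl = inj₁ refl

  -- Bases, spans and quotients.

  module Polymatroid {n} {f : Subset n → ℕ} (P : IsPolymatroid f) where
    open IsPolymatroid P

    diminishing : Diminishing f
    diminishing .increasing e A = monotone _ _ (⊆-insert e A)
    diminishing .exchange e {A} {B} A⊆B = begin
      f (insert e B) + f A                              ≤⟨ +-mono-≤ (monotone _ _ insert⊆) (monotone _ _ A⊆∩) ⟩
      f (insert e A ∪ B) + f (insert e A ∩ B)           ≤⟨ submodular (insert e A) B ⟩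
      f (insert e A) + f B                              ∎
      where
      open ≤-Reasoning
      insert⊆ : insert e B ⊆ insert e A ∪ B
      insert⊆ = insert-⊆ (q⊆p∪q (insert e A) B) (p⊆p∪q B (∈-insert e A))
      A⊆∩ : A ⊆ insert e A ∩ B
      A⊆∩ x∈A = x∈p∩q⁺ (⊆-insert e A x∈A , A⊆B x∈A)

    f≤rank : ∀ A → f A ≤ f ⊤
    f≤rank A = monotone A ⊤ ⊆⊤

    marginal≤deficit : ∀ e A → marginal f e A ≤ f ⊤ ∸ f A
    marginal≤deficit e A = ∸-monoˡ-≤ (f A) (f≤rank _)

    -- Each base closes the deficit of `A` on its own, so by `union-bound` its marginals sum to at
    -- least the deficit. Exchanging the two sums counts each element at most once, by disjointness.
    bases-bound : ∀ {k} (B : Fin k → Subset n) → PairwiseDisjoint B → (∀ i → IsBase f (B i)) → ∀ A →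
                  k * (f ⊤ ∸ f A) ≤ sum (λ e → marginal f e A)
    bases-bound {k} B disjoint base A = begin
      k * (f ⊤ ∸ f A)                                                        ≡⟨ sum-const k _ ⟨
      sum {k} (λ _ → f ⊤ ∸ f A)                                              ≤⟨ sum-mono one-base ⟩
      sum (λ i → sum (λ e → when (lookup (B i) e) (marginal f e A)))         ≡⟨ ∑-comm (λ i e → when (lookup (B i) e) (marginal f e A)) ⟩
      sum (λ e → sum (λ i → when (lookup (B i) e) (marginal f e A)))         ≤⟨ sum-mono (λ e → sum-when-unique (λ i → lookup (B i) e) _ (unique e)) ⟩
      sum (λ e → marginal f e A)                                             ∎
      where
      open ≤-Reasoning
      one-base : ∀ i → f ⊤ ∸ f A ≤ sum (λ e → when (lookup (B i) e) (marginal f e A))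
      one-base i = m≤n+o⇒m∸n≤o _ (f A) (≤-trans
        (≤-trans (≤-reflexive (sym (base i))) (monotone _ _ (q⊆p∪q A (B i)))) (union-bound diminishing A (B i)))
      unique : ∀ e i j → lookup (B i) e ≡ true → lookup (B j) e ≡ true → i ≡ j
      unique e i j p q with i Data.Fin.≟ j
      ... | yes i≡j = i≡j
      ... | no i≢j = contradiction (subst (e ∈_) (disjoint i j i≢j) (x∈p∩q⁺ (lookup⇒[]= e _ p , lookup⇒[]= e _ q))) ∉⊥

    -- The complement of the span of A.
    active : Subset n → Fin n → Bool
    active A e = f A <ᵇ f (insert e A)

    -- f (A ∪ W) = f A when W lies in the span of A, so e, being outside the span, increases f W.
    active-increases : ∀ A W e → (∀ {x} → x ∈ W → active A x ≡ false) → active A e ≡ true → f W < f (insert e W)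
    active-increases A W e inactive act = +-cancelʳ-≤ (f (A ∪ W)) _ _ (begin
      suc (f W) + f (A ∪ W)               ≤⟨ +-monoʳ-≤ (suc (f W)) union≤ ⟩
      suc (f W) + f A                     ≡⟨ solve 2 (λ w a → con 1 :+ w :+ a := con 1 :+ a :+ w) refl (f W) (f A) ⟩
      suc (f A) + f W                     ≤⟨ +-monoˡ-≤ (f W) (<ᵇ-true⁻ act) ⟩
      f (insert e A) + f W                ≤⟨ +-monoˡ-≤ (f W) (monotone _ _ (insert-⊆ (⊆-trans (p⊆p∪q W) (⊆-insert e (A ∪ W))) (∈-insert e _))) ⟩
      f (insert e (A ∪ W)) + f W          ≤⟨ diminishing .exchange e (q⊆p∪q A W) ⟩
      f (insert e W) + f (A ∪ W)          ∎)
      where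
      open ≤-Reasoning
      open +-*-Solver
      flat : ∀ x → when (lookup W x) (marginal f x A) ≡ 0
      flat x with lookup W x in eq
      ... | false = refl
      ... | true = m≤n⇒m∸n≡0 (<ᵇ-false⁻ {f A} (inactive (lookup⇒[]= x W eq)))
      union≤ : f (A ∪ W) ≤ f A
      union≤ = ≤-trans (union-bound diminishing A W) (≤-reflexive (trans (cong (f A +_) (sum-zero flat)) (+-identityʳ (f A))))

    -- Every prefix element outside this set lies in the span of `A`, so `active-increases` applies
    -- to the whole complement `W`.
    active-quotient : ∀ A t → IsQuotientOn f (prefix t) (tabulate (active A) ∩ prefix t)
    active-quotient A t = p∩q⊆q _ _ , λ e e∈Q →
      subst (λ S → f W < f S) (insert≡∪ e W)
        (active-increases A W e inactive (∈-tabulate⁻ {b = active A} (proj₁ (x∈p∩q⁻ _ _ e∈Q))))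
      where
      W = prefix t ∩ ∁ (tabulate (active A) ∩ prefix t)
      inactive : ∀ {x} → x ∈ W → active A x ≡ false
      inactive {x} x∈W with active A x in eq
      ... | false = refl
      ... | true = contradiction (x∈p∩q⁺ (∈-tabulate⁺ {b = active A} eq , proj₁ (x∈p∩q⁻ _ _ x∈W))) (x∈∁p⇒x∉p (proj₂ (x∈p∩q⁻ _ _ x∈W)))

    ∈-prefix : ∀ {e t : Fin n} → toℕ e ≤ toℕ t → e ∈ prefix t
    ∈-prefix {e} {t} e≤t = ∈-tabulate⁺ (≤ᵇ-true e≤t)

    -- As `t` arrives last in `V`, what remains of `V` lies in the complement `W` of `Q` in the
    -- prefix. Since `t` increases `f W`, diminishing returns make it increase `f V'` as well, and
    -- `V` contains both `V'` and `t`.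
    remove-quotient : ∀ {t V Q} → IsQuotientOn f (prefix t) Q → t ∈ Q → t ∈ V →
                      (∀ {e} → e ∈ V → toℕ e ≤ toℕ t) → f (V ∩ ∁ Q) < f V
    remove-quotient {t} {V} {Q} (_ , quot) t∈Q t∈V last = <-≤-trans
      (+-cancelʳ-≤ (f W) _ _ (begin
        suc (f V') + f W            ≡⟨ cong suc (+-comm (f V') (f W)) ⟩
        suc (f W) + f V'            ≤⟨ +-monoˡ-≤ (f V') (subst (λ S → f W < f S) (sym (insert≡∪ t W)) (quot t t∈Q)) ⟩
        f (insert t W) + f V'       ≤⟨ diminishing .exchange t V'⊆W ⟩
        f (insert t V') + f W       ∎))
      (monotone _ _ (insert-⊆ (p∩q⊆p V _) t∈V))
      where
      open ≤-Reasoning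
      W = prefix t ∩ ∁ Q
      V' = V ∩ ∁ Q
      V'⊆W : V' ⊆ W
      V'⊆W x∈ = x∈p∩q⁺ (∈-prefix {t = t} (last (p∩q⊆p V _ x∈)) , p∩q⊆q V _ x∈)

    -- Minimum quotient sizes and levels of elements.

    module _ {q : Fin n → ℕ} (q-min : ∀ i → IsMinQuotientSize f i (q i)) where

      -- The active elements that have arrived by time `t` form a quotient containing `t`, so the
      -- minimality of `q t` applies to them.
      q≤active : ∀ A t → active A t ≡ true → q t ≤ ∣ tabulate (active A) ∣
      q≤active A t act = ≤-trans
        (proj₂ (q-min t) _ (active-quotient A t) (x∈p∩q⁺ (∈-tabulate⁺ {b = active A} act , ∈-prefix {t} ≤-refl)))
        (∣p∩q∣≤∣p∣ (tabulate (active A)) (prefix t))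

      q-positive : ∀ t → 0 < q t
      q-positive t with q-min t
      ... | (Q , _ , t∈Q , size) , _ = subst (0 <_) size (≤-trans (≤-reflexive (sym (∣⁅x⁆∣≡1 t)))
        (p⊆q⇒∣p∣≤∣q∣ (λ x∈ → subst (_∈ Q) (sym (x∈⁅y⁆⇒x≡y t x∈)) t∈Q)))

      -- Removing a minimum quotient of the last element of V deletes at most m elements and lowers f.
      low-quotients-sparse : ∀ m V → (∀ {e} → e ∈ V → q e ≤ m) → ∣ V ∣ ≤ m * f V
      low-quotients-sparse m V = go (f V) V ≤-refl
        where
        open ≤-Reasoning
        -- `k` bounds the rank of the remaining set and is the recursion measure; for nonempty `V`
        -- the strict drop excludes `zero`.
        go : ∀ k V → f V ≤ k → (∀ {e} → e ∈ V → q e ≤ m) → ∣ V ∣ ≤ m * f V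
        go k V fV≤k low with last-element V
        ... | inj₁ refl = ≤-trans (≤-reflexive (∣⊥∣≡0 n)) z≤n
        ... | inj₂ (t , t∈V , last) with q-min t
        ... | (Q , quot , t∈Q , size) , _ with remove-quotient quot t∈Q t∈V last
        ... | drops with k
        ... | zero = contradiction (≤-trans drops fV≤k) λ ()
        ... | suc k' = begin
          ∣ V ∣                      ≤⟨ ∣∣-split V Q ⟩
          ∣ V ∩ ∁ Q ∣ + ∣ Q ∣        ≤⟨ +-mono-≤ (go k' (V ∩ ∁ Q) (≤-pred (≤-trans drops fV≤k)) (λ e∈ → low (p∩q⊆p V _ e∈)))
                                                 (≤-trans (≤-reflexive size) (low t∈V)) ⟩
          m * f (V ∩ ∁ Q) + m        ≡⟨ trans (+-comm _ m) (sym (*-suc m (f (V ∩ ∁ Q)))) ⟩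
          m * suc (f (V ∩ ∁ Q))      ≤⟨ *-monoʳ-≤ m drops ⟩
          m * f V                    ∎

      -- 2^R is o up to a constant factor. Unless e is small, level e is the least value of R_t in
      -- Algorithm 1 that is at least R; the truncation of ℓ e ∸ 3 * c at 0 is harmless as R ≥ 0.
      module Levels {o} (B : Fin o → Subset n) (disjoint : PairwiseDisjoint B) (base : ∀ i → IsBase f (B i))
               {c R} (1≤c : 1 ≤ c) (rank≤ : f ⊤ ≤ 2 ^ c) (R-low : 2 * 2 ^ R ≤ o)
               {ℓ : Fin n → ℕ} (q≤2^ℓ : ∀ e → q e ≤ 2 ^ ℓ e) (2^ℓ≤2q : ∀ e → 2 ^ ℓ e ≤ 2 * q e) where

        small : Fin n → Bool
        small e = ℓ e + 3 * c <ᵇ R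

        level : Fin n → ℕ
        level e = R ⊔ (ℓ e ∸ 3 * c)

        large-marginal : Subset n → Fin n → ℕ
        large-marginal A e = when (not (small e)) (marginal f e A)

        -- Small elements have `q e ≤ 2 ^ (R ∸ 3 * c)`, so by `low-quotients-sparse` their number is
        -- at most this power times the rank, and the rank is at most `2 ^ c`.
        small-count : ∣ tabulate small ∣ ≤ 2 ^ R
        small-count with R ≤? 3 * c
        -- No element is small here, since smallness would force `3 * c < R`; the choice `m = 0`
        -- then gives cardinality 0.
        ... | yes R≤3c = ≤-trans (low-quotients-sparse 0 (tabulate small) λ {e} e∈ →
                contradiction (≤-trans R≤3c (m≤n+m (3 * c) (ℓ e))) (<⇒≱ (<ᵇ-true⁻ (∈-tabulate⁻ e∈)))) z≤n
        ... | no R≰3c = begin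
          ∣ tabulate small ∣                            ≤⟨ low-quotients-sparse (2 ^ (R ∸ 3 * c)) (tabulate small) low ⟩
          2 ^ (R ∸ 3 * c) * f (tabulate small)          ≤⟨ *-monoʳ-≤ (2 ^ (R ∸ 3 * c)) (≤-trans (f≤rank _) rank≤) ⟩
          2 ^ (R ∸ 3 * c) * 2 ^ c                       ≤⟨ *-monoʳ-≤ (2 ^ (R ∸ 3 * c)) (^-monoʳ-≤ 2 (m≤n*m c 3)) ⟩
          2 ^ (R ∸ 3 * c) * 2 ^ (3 * c)                 ≡⟨ ^-distribˡ-+-* 2 (R ∸ 3 * c) (3 * c) ⟨
          2 ^ (R ∸ 3 * c + 3 * c)                       ≡⟨ cong (2 ^_) (m∸n+n≡m (<⇒≤ (≰⇒> R≰3c))) ⟩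
          2 ^ R                                         ∎
          where
          open ≤-Reasoning
          low : ∀ {e} → e ∈ tabulate small → q e ≤ 2 ^ (R ∸ 3 * c)
          low {e} e∈ = ≤-trans (q≤2^ℓ e) (^-monoʳ-≤ 2 (m+n≤o⇒m≤o∸n (ℓ e) {3 * c} {R} (<⇒≤ (<ᵇ-true⁻ {ℓ e + 3 * c} (∈-tabulate⁻ e∈)))))

        -- Used in both cases of `progress`: with marginals capped by the deficit, and with the
        -- indicator of the active set capped by 1.
        drop-small : ∀ {g : Fin n → ℕ} {A} b → (∀ e → g e ≤ b) → (∀ e → g e ≤ marginal f e A) →
                     sum g ≤ sum (large-marginal A) + ∣ tabulate small ∣ * b
        drop-small {g} {A} b g≤b g≤marginal = begin
          sum g                                                                    ≤⟨ sum-mono split ⟩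
          sum (λ e → large-marginal A e + when (lookup (tabulate small) e) 1 * b)  ≡⟨ ∑-distrib-+ (large-marginal A) (λ e → when (lookup (tabulate small) e) 1 * b) ⟩
          X + sum (λ e → when (lookup (tabulate small) e) 1 * b)                   ≡⟨ cong (X +_) (*-distribʳ-sum b (λ e → when (lookup (tabulate small) e) 1)) ⟨
          X + sum (λ e → when (lookup (tabulate small) e) 1) * b                   ≡⟨ cong (λ s → X + s * b) (∣∣-sum (tabulate small)) ⟨
          X + ∣ tabulate small ∣ * b                                               ∎
          where
          open ≤-Reasoning
          X = sum (large-marginal A)
          split : ∀ e → g e ≤ large-marginal A e + when (lookup (tabulate small) e) 1 * b
          split e rewrite lookup∘tabulate small e with small e
          ... | true = ≤-trans (g≤b e) (m≤m+n b 0)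
          ... | false = ≤-trans (g≤marginal e) (m≤m+n _ 0)

        -- A denominator-free form of the bound on marginals weighted by `2^(-level e)`: elements
        -- that are not active have marginal 0, and active ones have weight at least `2^(-R')`.
        progress : ∀ A → ∃ λ R' → (∀ e → active A e ≡ true → level e ≤ R') ×
                   (f ⊤ ∸ f A) * 2 ^ R' ≤ sum (large-marginal A)
        progress A with bounded-max (active A) level R
        -- The bases supply two copies of `2 ^ R * ρ`. Small elements can account for one copy,
        -- which is cancelled on both sides.
        ... | R' , _ , bound , inj₁ refl = R , bound , +-cancelʳ-≤ (2 ^ R * ρ) _ _ (begin
          ρ * 2 ^ R + 2 ^ R * ρ          ≡⟨ solve 2 (λ x y → x :* y :+ y :* x := con 2 :* y :* x) refl ρ (2 ^ R) ⟩
          2 * 2 ^ R * ρ                  ≤⟨ *-monoˡ-≤ ρ R-low ⟩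
          o * ρ                          ≤⟨ bases-bound B disjoint base A ⟩
          sum (λ e → marginal f e A)     ≤⟨ drop-small ρ (λ e → marginal≤deficit e A) (λ e → ≤-refl) ⟩
          X + ∣ tabulate small ∣ * ρ     ≤⟨ +-monoʳ-≤ X (*-monoˡ-≤ ρ small-count) ⟩
          X + 2 ^ R * ρ                  ∎)
          where
          open ≤-Reasoning
          open +-*-Solver
          ρ = f ⊤ ∸ f A
          X = sum (large-marginal A)
        -- The active set has at least `q t` elements, and `2 * q t` is at least `2 ^ ℓ t`, that is
        -- `x * x * x * y`. The outer factor 2 absorbs this rounding of the logarithm; the extra `y`
        -- pays for the small elements, since `2 ^ suc R ≤ y`.
        ... | R' , _ , bound , inj₂ (t , act , level≡ , R<R') = R' , bound , *-cancelˡ-≤ 2 (+-cancelʳ-≤ y _ _ (begin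
          2 * (ρ * y) + y                      ≤⟨ +-monoˡ-≤ y (*-monoʳ-≤ 2 (*-monoˡ-≤ y (≤-trans (m∸n≤m _ (f A)) rank≤))) ⟩
          2 * (x * y) + y                      ≡⟨ solve 2 (λ x y → con 2 :* (x :* y) :+ y := (con 1 :+ con 2 :* x) :* y) refl x y ⟩
          (1 + 2 * x) * y                      ≤⟨ *-monoˡ-≤ y cube ⟩
          x * x * x * y                        ≡⟨ 2^3c ⟨
          2 ^ (R' + 3 * c)                     ≡⟨ cong (2 ^_) ℓ≡ ⟨
          2 ^ ℓ t                              ≤⟨ 2^ℓ≤2q t ⟩
          2 * q t                              ≤⟨ *-monoʳ-≤ 2 (q≤active A t act) ⟩
          2 * ∣ tabulate (active A) ∣          ≡⟨ cong (2 *_) (∣∣-sum (tabulate (active A))) ⟩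
          2 * sum (λ e → when (lookup (tabulate (active A)) e) 1)
            ≤⟨ *-monoʳ-≤ 2 (drop-small 1 (λ e → when-≤ (lookup (tabulate (active A)) e) 1) active≤marginal) ⟩
          2 * (X + ∣ tabulate small ∣ * 1)     ≡⟨ solve 2 (λ x s → con 2 :* (x :+ s :* con 1) := con 2 :* x :+ con 2 :* s) refl X ∣ tabulate small ∣ ⟩
          2 * X + 2 * ∣ tabulate small ∣       ≤⟨ +-monoʳ-≤ (2 * X) (*-monoʳ-≤ 2 small-count) ⟩
          2 * X + 2 ^ suc R                    ≤⟨ +-monoʳ-≤ (2 * X) (^-monoʳ-≤ 2 R<R') ⟩
          2 * X + y                            ∎))
          where
          open ≤-Reasoning
          open +-*-Solver
          ρ = f ⊤ ∸ f A
          X = sum (large-marginal A)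
          x = 2 ^ c
          y = 2 ^ R'
          2≤x : 2 ≤ x
          2≤x = ^-monoʳ-≤ 2 1≤c
          cube : 1 + 2 * x ≤ x * x * x
          cube = begin
            1 + 2 * x            ≤⟨ +-monoˡ-≤ (2 * x) (≤-trans (s≤s z≤n) (≤-trans 2≤x (m≤m+n x (x + 0)))) ⟩
            2 * x + 2 * x        ≡⟨ solve 1 (λ x → con 2 :* x :+ con 2 :* x := con 2 :* con 2 :* x) refl x ⟩
            2 * 2 * x            ≤⟨ *-monoˡ-≤ x (*-mono-≤ 2≤x 2≤x) ⟩
            x * x * x            ∎
          2^3c : 2 ^ (R' + 3 * c) ≡ x * x * x * y
          2^3c = trans (^-distribˡ-+-* 2 R' (3 * c)) (trans (cong (y *_) (trans (cong (2 ^_) (*-comm 3 c)) (sym (^-*-assoc 2 c 3))))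
            (solve 2 (λ x y → y :* (x :* (x :* (x :* con 1))) := x :* x :* x :* y) refl x y))
          -- A level above `R` must be the second argument of the maximum; being positive, the
          -- truncated difference is a true one.
          ℓ≡ : ℓ t ≡ R' + 3 * c
          ℓ≡ with ⊔-sel R (ℓ t ∸ 3 * c)
          ... | inj₁ eq = contradiction (trans (sym eq) level≡) (<⇒≢ R<R')
          ... | inj₂ eq = trans (sym (m∸n+n≡m 3c≤ℓ)) (cong (_+ 3 * c) diff)
            where
            diff : ℓ t ∸ 3 * c ≡ R'
            diff = trans (sym eq) level≡
            3c≤ℓ : 3 * c ≤ ℓ t
            3c≤ℓ = <⇒≤ (m∸n≢0⇒n<m λ d≡0 → contradiction (subst (R <_) (trans (sym diff) d≡0) R<R') λ ())
          active≤marginal : ∀ e → when (lookup (tabulate (active A)) e) 1 ≤ marginal f e A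
          active≤marginal e rewrite lookup∘tabulate (active A) e with active A e in eq
          ... | true = m<n⇒0<n∸m (<ᵇ-true⁻ {f A} eq)
          ... | false = z≤n

-- Rounded logarithms and palette sizes.

module Palettes where
  open import Data.Nat
  open import Data.Nat.Properties
  open import Data.Nat.Induction using (<-rec)
  open import Data.Nat.Logarithm
  open import Data.Nat.Solver using (module +-*-Solver)
  open import Data.Integer using (+_)
  open import Data.Product using (_,_)
  open import Data.Sum using (inj₁; inj₂)
  open import Relation.Nullary using (contradiction)
  open import Relation.Binary.PropositionalEquality using (refl; sym; trans; cong)
  open ≤-Reasoning
  open +-*-Solver

  -- Strong induction through `⌈ n /2⌉`, whose rounded logarithm is one less; for `n ≥ 2` the
  -- truncated predecessor is exact.
  n≤2^⌈log₂n⌉ : ∀ n → n ≤ 2 ^ ⌈log₂ n ⌉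
  n≤2^⌈log₂n⌉ = <-rec _ λ where
    zero _ → z≤n
    (suc zero) _ → m^n>0 2 ⌈log₂ 1 ⌉
    n@(suc (suc m)) rec → begin
      n                                   ≡⟨ ⌊n/2⌋+⌈n/2⌉≡n n ⟨
      ⌊ n /2⌋ + ⌈ n /2⌉                   ≤⟨ +-monoˡ-≤ ⌈ n /2⌉ (⌊n/2⌋≤⌈n/2⌉ n) ⟩
      ⌈ n /2⌉ + ⌈ n /2⌉                   ≤⟨ +-mono-≤ (rec (⌈n/2⌉<n m)) (rec (⌈n/2⌉<n m)) ⟩
      2 ^ ⌈log₂ ⌈ n /2⌉ ⌉ + 2 ^ ⌈log₂ ⌈ n /2⌉ ⌉   ≡⟨ cong (λ k → 2 ^ ⌈log₂ ⌈ n /2⌉ ⌉ + k) (+-identityʳ _) ⟨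
      2 ^ suc ⌈log₂ ⌈ n /2⌉ ⌉             ≡⟨ cong (λ k → 2 ^ suc k) (⌈log₂⌈n/2⌉⌉≡⌈log₂n⌉∸1 n) ⟩
      2 ^ suc (⌈log₂ n ⌉ ∸ 1)             ≡⟨ cong (2 ^_) (m+[n∸m]≡n (⌈log₂⌉-mono-≤ {2} {n} (s≤s (s≤s z≤n)))) ⟩
      2 ^ ⌈log₂ n ⌉                       ∎

  -- If the rounded logarithm is `suc k`, then `n < 2 ^ k` would bring it down to `k` by
  -- monotonicity.
  2^⌈log₂n⌉≤2n : ∀ {n} → 0 < n → 2 ^ ⌈log₂ n ⌉ ≤ 2 * n
  2^⌈log₂n⌉≤2n {n} 0<n with ⌈log₂ n ⌉ in eq
  ... | zero = ≤-trans 0<n (m≤m+n n _)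
  ... | suc k = *-monoʳ-≤ 2 {2 ^ k} {n} (≮⇒≥ λ n<2^k → 1+n≰n (begin
    suc k              ≡⟨ eq ⟨
    ⌈log₂ n ⌉          ≤⟨ ⌈log₂⌉-mono-≤ {n} (<⇒≤ n<2^k) ⟩
    ⌈log₂ 2 ^ k ⌉      ≡⟨ ⌈log₂2^n⌉≡n k ⟩
    k                  ∎))

  2^-cancel-≤ : ∀ {m n} → 2 ^ m ≤ 2 ^ n → m ≤ n
  2^-cancel-≤ {m} {n} le = ≮⇒≥ λ n<m → <⇒≱ (^-monoʳ-< 2 (s≤s (s≤s z≤n)) n<m) le

  module Palette {r : ℕ} (2≤r : 2 ≤ r) where
    c : ℕ
    c = ⌈log₂ r ⌉

    1≤c : 1 ≤ c
    1≤c = ⌈log₂⌉-mono-≤ 2≤r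

    r≤2^c : r ≤ 2 ^ c
    r≤2^c = n≤2^⌈log₂n⌉ r

    -- Rounding up costs a factor 2, which is at most `r`. In logarithms: `c / 2 ≤ log₂ r`.
    2^c≤r² : 2 ^ c ≤ r ^ 2
    2^c≤r² = begin
      2 ^ c    ≤⟨ 2^⌈log₂n⌉≤2n (≤-trans (s≤s z≤n) 2≤r) ⟩
      2 * r    ≤⟨ *-monoˡ-≤ r 2≤r ⟩
      r * r    ≡⟨ cong (r *_) (*-identityʳ r) ⟨
      r ^ 2    ∎

    -- c/2 ≤ log₂ r is the rational instance used.
    palette-upper : ∀ {k m} → PaletteSize r (+ k) m → 15 * m * (c * c) ≤ 2 ^ k
    palette-upper (inj₁ (r≤1 , _)) = contradiction (≤-trans 2≤r r≤1) λ { (s≤s ()) }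
    palette-upper {k} {m} (inj₂ (_ , ¬over , _)) = *-cancelʳ-≤ _ _ 4 (begin
      15 * m * (c * c) * 4       ≡⟨ solve 2 (λ m x → con 15 :* m :* x :* con 4 := con 60 :* m :* x) refl m (c * c) ⟩
      60 * m * (c * c)           ≤⟨ ≮⇒≥ (λ over → ¬over (c , 1 , 2^c≤r² , over)) ⟩
      2 ^ k * 4                  ∎)

    -- The rational `a / suc b` witnessing `Over` is at most `log₂ r`, hence at most `c`, and may be
    -- replaced by `c`.
    palette-lower : ∀ {k m} → PaletteSize r (+ k) m → 2 ^ k < 60 * suc m * (c * c)
    palette-lower (inj₁ (r≤1 , _)) = contradiction (≤-trans 2≤r r≤1) λ { (s≤s ()) }
    palette-lower {k} {m} (inj₂ (_ , _ , a , b , 2^a≤ , over)) = *-cancelʳ-< (suc b * suc b) _ _ (begin-strict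
      2 ^ k * (suc b * suc b)                           <⟨ over ⟩
      60 * suc m * (a * a)                              ≤⟨ *-monoʳ-≤ (60 * suc m) (*-mono-≤ a≤ a≤) ⟩
      60 * suc m * (c * suc b * (c * suc b))            ≡⟨ solve 3 (λ p c b → p :* (c :* b :* (c :* b)) := p :* (c :* c) :* (b :* b)) refl (60 * suc m) c (suc b) ⟩
      60 * suc m * (c * c) * (suc b * suc b)            ∎)
      where
      a≤ : a ≤ c * suc b
      a≤ = 2^-cancel-≤ (begin
        2 ^ a              ≤⟨ 2^a≤ ⟩
        r ^ suc b          ≤⟨ ^-monoˡ-≤ (suc b) r≤2^c ⟩
        (2 ^ c) ^ suc b    ≡⟨ ^-*-assoc 2 c (suc b) ⟩
        2 ^ (c * suc b)    ∎)

    -- If `m' < m`, the witness that `suc m'` is too large for exponent `k'` would also show that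
    -- `m` is too large for `k`.
    palette-mono : ∀ {k k' m m'} → PaletteSize r (+ k) m → PaletteSize r (+ k') m' → k ≤ k' → m ≤ m'
    palette-mono (inj₁ (r≤1 , _)) _ _ = contradiction (≤-trans 2≤r r≤1) λ { (s≤s ()) }
    palette-mono (inj₂ _) (inj₁ (r≤1 , _)) _ = contradiction (≤-trans 2≤r r≤1) λ { (s≤s ()) }
    palette-mono {k} {k'} {m} {m'} (inj₂ (_ , ¬over , _)) (inj₂ (_ , _ , a , b , 2^a≤ , over)) k≤k' =
      ≮⇒≥ λ m'<m → ¬over (a , b , 2^a≤ , (begin-strict
        2 ^ k * (suc b * suc b)      ≤⟨ *-monoˡ-≤ (suc b * suc b) (^-monoʳ-≤ 2 {k} k≤k') ⟩
        2 ^ k' * (suc b * suc b)     <⟨ over ⟩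
        60 * suc m' * (a * a)        ≤⟨ *-monoˡ-≤ (a * a) (*-monoʳ-≤ 60 m'<m) ⟩
        60 * m * (a * a)             ∎))

    -- A given guess has probability `1/(6c+1)` and a given color then `1/m`; this makes room for
    -- `c + 1` rounds of rate `2^(-k)`. Since `c ≥ 1`, the product `(c+1)(6c+1)` is at most `14c²`,
    -- below the `15c²` of `palette-upper`.
    palette-weight : ∀ {k m} → PaletteSize r (+ k) m → suc c * (suc (6 * c) * m) ≤ 2 ^ k
    palette-weight {k} {m} size = begin
      suc c * (suc (6 * c) * m)                   ≡⟨ solve 2 (λ c m → (con 1 :+ c) :* ((con 1 :+ con 6 :* c) :* m)
                                                       := m :* (con 6 :* (c :* c) :+ con 7 :* c :+ con 1)) refl c m ⟩
      m * (6 * (c * c) + 7 * c + 1)               ≤⟨ *-monoʳ-≤ m (+-mono-≤ (+-monoʳ-≤ (6 * (c * c)) (*-monoʳ-≤ 7 c≤c²)) (≤-trans 1≤c c≤c²)) ⟩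
      m * (6 * (c * c) + 7 * (c * c) + c * c)     ≡⟨ solve 2 (λ x m → m :* (con 6 :* x :+ con 7 :* x :+ x) := con 14 :* (m :* x)) refl (c * c) m ⟩
      14 * (m * (c * c))                          ≤⟨ *-monoˡ-≤ (m * (c * c)) (n≤1+n 14) ⟩
      15 * (m * (c * c))                          ≡⟨ *-assoc 15 m (c * c) ⟨
      15 * m * (c * c)                            ≤⟨ palette-upper {k} size ⟩
      2 ^ k                                       ∎
      where
      c≤c² : c ≤ c * c
      c≤c² = ≤-trans (≤-reflexive (sym (*-identityʳ c))) (*-monoʳ-≤ c 1≤c)

    -- Follows from `2^c≤r²` by comparing powers of 2. It lets `ratioBound` replace `c` by twice any
    -- rational upper approximation of `log₂ r`.
    c-upper : ∀ {a b} → r ^ b ≤ 2 ^ a → c * b ≤ 2 * a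
    c-upper {a} {b} r^b≤ = 2^-cancel-≤ (begin
      2 ^ (c * b)        ≡⟨ ^-*-assoc 2 c b ⟨
      (2 ^ c) ^ b        ≤⟨ ^-monoˡ-≤ b 2^c≤r² ⟩
      (r ^ 2) ^ b        ≡⟨ trans (^-*-assoc r 2 b) (trans (cong (r ^_) (*-comm 2 b)) (sym (^-*-assoc r b 2))) ⟩
      (r ^ b) ^ 2        ≤⟨ ^-monoˡ-≤ 2 r^b≤ ⟩
      (2 ^ a) ^ 2        ≡⟨ trans (^-*-assoc 2 a 2) (cong (2 ^_) (*-comm a 2)) ⟩
      2 ^ (2 * a)        ∎)

-- Rational arithmetic and the multilinear extension.

module MultilinearExtension where
  open import Data.Nat as ℕ using (ℕ; zero; suc)
  import Data.Nat.Properties as ℕP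
  open import Data.Integer as ℤ using (ℤ; +_)
  import Data.Integer.Properties as ℤP
  open import Data.Rational using (ℚ; 0ℚ; 1ℚ; _/_; _+_; _*_; _-_; -_; _≤_; _<_; fromℚᵘ; toℚᵘ; nonNegative; positive)
  open import Data.Rational.Properties
  open import Data.Rational.Solver using (module +-*-Solver)
  open import Data.Rational.Unnormalised as ℚᵘ using (ℚᵘ; mkℚᵘ; *≡*; *≤*)
  import Data.Rational.Unnormalised.Properties as ℚᵘP
  open import Data.Bool using (Bool)
  open import Data.Fin using (Fin; zero; suc)
  open import Data.Fin.Subset using (Subset; inside; outside; _⊆_)
  open import Data.Fin.Subset.Properties using (s⊆s; out⊆; ⊆-refl)
  open import Data.Vec using ([]; _∷_)
  open import Algebra.Properties.CommutativeMonoid.Sum +-0-commutativeMonoid using () renaming (sum to ∑)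
  open import Data.Product using (_×_; _,_; proj₁; proj₂)
  open import Function using (_∘_)
  open import Relation.Binary.PropositionalEquality using (_≡_; refl; sym; trans; cong; cong₂; subst; subst₂; module ≡-Reasoning)

  open Quotients using (insert)

  -- `fromℚᵘ (mkℚᵘ p d)` computes to `p / suc d`, so identities between fractions can be proved
  -- without normalisation and then carried over.
  fromℚᵘ-homo-+ : ∀ p q → fromℚᵘ (p ℚᵘ.+ q) ≡ fromℚᵘ p + fromℚᵘ q
  fromℚᵘ-homo-+ p q = toℚᵘ-injective (begin
    toℚᵘ (fromℚᵘ (p ℚᵘ.+ q))                ≈⟨ toℚᵘ-fromℚᵘ (p ℚᵘ.+ q) ⟩
    p ℚᵘ.+ q                                ≈⟨ ℚᵘP.+-cong (toℚᵘ-fromℚᵘ p) (toℚᵘ-fromℚᵘ q) ⟨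
    toℚᵘ (fromℚᵘ p) ℚᵘ.+ toℚᵘ (fromℚᵘ q)    ≈⟨ toℚᵘ-homo-+ (fromℚᵘ p) (fromℚᵘ q) ⟨
    toℚᵘ (fromℚᵘ p + fromℚᵘ q)              ∎)
    where open ℚᵘP.≃-Reasoning

  fromℚᵘ-homo-* : ∀ p q → fromℚᵘ (p ℚᵘ.* q) ≡ fromℚᵘ p * fromℚᵘ q
  fromℚᵘ-homo-* p q = toℚᵘ-injective (begin
    toℚᵘ (fromℚᵘ (p ℚᵘ.* q))                ≈⟨ toℚᵘ-fromℚᵘ (p ℚᵘ.* q) ⟩
    p ℚᵘ.* q                                ≈⟨ ℚᵘP.*-cong (toℚᵘ-fromℚᵘ p) (toℚᵘ-fromℚᵘ q) ⟨
    toℚᵘ (fromℚᵘ p) ℚᵘ.* toℚᵘ (fromℚᵘ q)    ≈⟨ toℚᵘ-homo-* (fromℚᵘ p) (fromℚᵘ q) ⟨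
    toℚᵘ (fromℚᵘ p * fromℚᵘ q)              ∎)
    where open ℚᵘP.≃-Reasoning

  fromℚᵘ-mono-≤ : ∀ {p q} → p ℚᵘ.≤ q → fromℚᵘ p ≤ fromℚᵘ q
  fromℚᵘ-mono-≤ {p} {q} p≤q = toℚᵘ-cancel-≤
    (ℚᵘP.≤-respˡ-≃ (ℚᵘP.≃-sym (toℚᵘ-fromℚᵘ p)) (ℚᵘP.≤-respʳ-≃ (ℚᵘP.≃-sym (toℚᵘ-fromℚᵘ q)) p≤q))

  ι : ℕ → ℚ
  ι = ℕtoℚ

  ι-+ : ∀ a b → ι (a ℕ.+ b) ≡ ι a + ι b
  ι-+ a b = trans (fromℚᵘ-cong {mkℚᵘ (+ (a ℕ.+ b)) 0} {mkℚᵘ (+ a) 0 ℚᵘ.+ mkℚᵘ (+ b) 0} (*≡* (cong (ℤ._* + 1) (sym eq)))) (fromℚᵘ-homo-+ (mkℚᵘ (+ a) 0) (mkℚᵘ (+ b) 0))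
    where
    eq : + a ℤ.* + 1 ℤ.+ + b ℤ.* + 1 ≡ + (a ℕ.+ b)
    eq = cong₂ ℤ._+_ (ℤP.*-identityʳ (+ a)) (ℤP.*-identityʳ (+ b))

  ι-* : ∀ a b → ι (a ℕ.* b) ≡ ι a * ι b
  ι-* a b = trans (fromℚᵘ-cong {mkℚᵘ (+ (a ℕ.* b)) 0} {mkℚᵘ (+ a) 0 ℚᵘ.* mkℚᵘ (+ b) 0} (*≡* (cong (ℤ._* + 1) (ℤP.pos-* a b)))) (fromℚᵘ-homo-* (mkℚᵘ (+ a) 0) (mkℚᵘ (+ b) 0))

  ι-mono : ∀ {a b} → a ℕ.≤ b → ι a ≤ ι b
  ι-mono {a} {b} a≤b = fromℚᵘ-mono-≤ {mkℚᵘ (+ a) 0} {mkℚᵘ (+ b) 0} (*≤* (ℤP.*-monoʳ-≤-nonNeg (+ 1) (ℤ.+≤+ a≤b)))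

  ι-nonneg : ∀ a → 0ℚ ≤ ι a
  ι-nonneg a = ι-mono {0} {a} ℕ.z≤n

  ι-pos : ∀ a → 0ℚ < ι (suc a)
  ι-pos a = <-≤-trans (positive⁻¹ 1ℚ) (ι-mono {1} {suc a} (ℕ.s≤s ℕ.z≤n))

  frac-cancel : ∀ a d .{{_ : ℕ.NonZero d}} → (+ a / d) * ι d ≡ ι a
  frac-cancel a (suc d) = trans (sym (fromℚᵘ-homo-* (mkℚᵘ (+ a) d) (mkℚᵘ (+ suc d) 0)))
    (fromℚᵘ-cong {mkℚᵘ (+ a) d ℚᵘ.* mkℚᵘ (+ suc d) 0} {mkℚᵘ (+ a) 0}
      (*≡* (trans (ℤP.*-identityʳ _) (cong (λ k → + a ℤ.* + suc k) (sym (ℕP.*-identityʳ d))))))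

  0≤1 : 0ℚ ≤ 1ℚ
  0≤1 = ι-nonneg 1

  *-nonneg : ∀ {p q} → 0ℚ ≤ p → 0ℚ ≤ q → 0ℚ ≤ p * q
  *-nonneg {p} {q} 0≤p 0≤q = nonNegative⁻¹ (p * q)
    {{nonNeg*nonNeg⇒nonNeg p {{nonNegative 0≤p}} q {{nonNegative 0≤q}}}}

  *-monoˡ : ∀ {p q} r → 0ℚ ≤ r → p ≤ q → r * p ≤ r * q
  *-monoˡ r 0≤r = *-monoˡ-≤-nonNeg r {{nonNegative 0≤r}}

  *-monoʳ : ∀ {p q} r → 0ℚ ≤ r → p ≤ q → p * r ≤ q * r
  *-monoʳ r 0≤r = *-monoʳ-≤-nonNeg r {{nonNegative 0≤r}}

  *-cancelʳ : ∀ {p q} r → 0ℚ < r → p * r ≤ q * r → p ≤ q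
  *-cancelʳ r 0<r = *-cancelʳ-≤-pos r {{positive 0<r}}

  frac-nonneg : ∀ a d .{{_ : ℕ.NonZero d}} → 0ℚ ≤ + a / d
  frac-nonneg a (suc d) = *-cancelʳ (ι (suc d)) (ι-pos d)
    (subst₂ _≤_ (sym (*-zeroˡ (ι (suc d)))) (sym (frac-cancel a (suc d))) (ι-nonneg a))

  ≤⇒0≤- : ∀ {p q} → p ≤ q → 0ℚ ≤ q - p
  ≤⇒0≤- {p} {q} p≤q = subst (_≤ q - p) (+-inverseʳ p) (+-monoˡ-≤ (- p) p≤q)

  -- Separates an inequality into a nonnegative difference `d` and an equation that the ring solver
  -- can check.
  slack : ∀ {p q} d → 0ℚ ≤ d → p + d ≡ q → p ≤ q
  slack {p} {q} d 0≤d eq = subst₂ _≤_ (+-identityʳ p) eq (+-monoʳ-≤ p 0≤d)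

  +-nonneg : ∀ {p q} → 0ℚ ≤ p → 0ℚ ≤ q → 0ℚ ≤ p + q
  +-nonneg {p} {q} a b = subst (_≤ p + q) (+-identityˡ 0ℚ) (+-mono-≤ a b)

  ∑-mono : ∀ {n} {g h : Fin n → ℚ} → (∀ i → g i ≤ h i) → ∑ g ≤ ∑ h
  ∑-mono {zero} le = ≤-refl
  ∑-mono {suc n} le = +-mono-≤ (le zero) (∑-mono (le ∘ suc))

  -- E p h is the expectation of h at a random subset containing each i independently with
  -- probability p i, that is, the multilinear extension of h.
  E : ∀ {n} → (Fin n → ℚ) → (Subset n → ℚ) → ℚ
  E {zero} p h = h []
  E {suc n} p h = p zero * E (p ∘ suc) (h ∘ (inside ∷_)) + (1ℚ - p zero) * E (p ∘ suc) (h ∘ (outside ∷_))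

  Probability : ∀ {n} → (Fin n → ℚ) → Set
  Probability p = ∀ i → 0ℚ ≤ p i × p i ≤ 1ℚ

  E-mono : ∀ {n} {p : Fin n → ℚ} → Probability p → ∀ {h k} → (∀ A → h A ≤ k A) → E p h ≤ E p k
  E-mono {zero} pr le = le []
  E-mono {suc n} {p} pr le = +-mono-≤
    (*-monoˡ (p zero) (proj₁ (pr zero)) (E-mono (pr ∘ suc) (le ∘ (inside ∷_))))
    (*-monoˡ (1ℚ - p zero) (≤⇒0≤- (proj₂ (pr zero))) (E-mono (pr ∘ suc) (le ∘ (outside ∷_))))

  E-cong : ∀ {n} (p : Fin n → ℚ) {h k} → (∀ A → h A ≡ k A) → E p h ≡ E p k
  E-cong {zero} p eq = eq []
  E-cong {suc n} p eq = cong₂ (λ x y → p zero * x + (1ℚ - p zero) * y)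
    (E-cong (p ∘ suc) (eq ∘ (inside ∷_))) (E-cong (p ∘ suc) (eq ∘ (outside ∷_)))

  E-const : ∀ {n} (p : Fin n → ℚ) a → E p (λ _ → a) ≡ a
  E-const {zero} p a = refl
  E-const {suc n} p a = trans (cong₂ (λ x y → p zero * x + (1ℚ - p zero) * y) (E-const (p ∘ suc) a) (E-const (p ∘ suc) a))
    (solve 2 (λ p a → p :* a :+ (con 1ℚ :- p) :* a := a) refl (p zero) a)
    where open +-*-Solver

  E-lin : ∀ {n} (p : Fin n → ℚ) a h k → E p (λ A → a * h A + k A) ≡ a * E p h + E p k
  E-lin {zero} p a h k = refl
  E-lin {suc n} p a h k = trans
    (cong₂ (λ x y → p zero * x + (1ℚ - p zero) * y) (E-lin (p ∘ suc) a _ _) (E-lin (p ∘ suc) a _ _))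
    (solve 6 (λ p a x y z w → p :* (a :* x :+ y) :+ (con 1ℚ :- p) :* (a :* z :+ w)
       := a :* (p :* x :+ (con 1ℚ :- p) :* z) :+ (p :* y :+ (con 1ℚ :- p) :* w)) refl
       (p zero) a _ _ _ _)
    where open +-*-Solver

  E-minus : ∀ {n} (p : Fin n → ℚ) a h → E p (λ A → a - h A) ≡ a - E p h
  E-minus p a h = trans (E-cong p (λ A → reorder (h A)))
    (trans (E-lin p (- 1ℚ) h (λ _ → a)) (trans (cong (λ s → - 1ℚ * E p h + s) (E-const p a)) (sym (reorder (E p h)))))
    where
    open +-*-Solver
    reorder : ∀ x → a - x ≡ - 1ℚ * x + a
    reorder x = solve 2 (λ a x → a :- x := con (- 1ℚ) :* x :+ a) refl a x

  Antitone : ∀ {n} → (Subset n → ℚ) → Set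
  Antitone h = ∀ {A B} → A ⊆ B → h B ≤ h A

  -- After the induction on the tail, raising the first probability moves mass `z₀ - y₀` from the
  -- outside branch to the inside branch, where `h` is smaller.
  E-antitone : ∀ {n} {y z : Fin n → ℚ} → Probability y → Probability z → (∀ i → y i ≤ z i) →
               ∀ {h} → Antitone h → E z h ≤ E y h
  E-antitone {zero} py pz le anti = ≤-refl
  E-antitone {suc n} {y} {z} py pz le {h} anti = ≤-trans
    (+-mono-≤ (*-monoˡ z₀ (proj₁ (pz zero)) a≤a') (*-monoˡ (1ℚ - z₀) (≤⇒0≤- (proj₂ (pz zero))) b≤b'))
    (slack ((z₀ - y₀) * (b' - a')) (*-nonneg (≤⇒0≤- (le zero)) (≤⇒0≤- a'≤b'))
      (solve 4 (λ y z a b → z :* a :+ (con 1ℚ :- z) :* b :+ (z :- y) :* (b :- a)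
                  := y :* a :+ (con 1ℚ :- y) :* b) refl y₀ z₀ a' b'))
    where
    open +-*-Solver
    y₀ = y zero
    z₀ = z zero
    a' = E (y ∘ suc) (h ∘ (inside ∷_))
    b' = E (y ∘ suc) (h ∘ (outside ∷_))
    a≤a' = E-antitone (py ∘ suc) (pz ∘ suc) (le ∘ suc) {h ∘ (inside ∷_)} (anti ∘ s⊆s)
    b≤b' = E-antitone (py ∘ suc) (pz ∘ suc) (le ∘ suc) {h ∘ (outside ∷_)} (anti ∘ s⊆s)
    a'≤b' = E-mono (py ∘ suc) (λ A → anti (out⊆ ⊆-refl))

  -- Concavity along nonnegative directions and decay of the deficit.

  Δ : ∀ {n} → (Subset n → ℚ) → Fin n → Subset n → ℚ
  Δ h e A = h (insert e A) - h A

  record Submodular {n} (h : Subset n → ℚ) : Set where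
    field Δ-antitone : ∀ e → Antitone (Δ h e)
  open Submodular

  cons-submodular : ∀ {n} {h : Subset (suc n) → ℚ} b → Submodular h → Submodular (h ∘ (b ∷_))
  cons-submodular b sub .Δ-antitone e A⊆B = sub .Δ-antitone (suc e) (s⊆s A⊆B)

  -- Members of `A` contribute 0. Hence the expectation at `z` weights each partial derivative of
  -- the extension by `w e * (1 - z e)`, which for monotone `h` and nonnegative `w` is at most the
  -- derivative along `w`.
  gain : ∀ {n} → (Fin n → ℚ) → (Subset n → ℚ) → Subset n → ℚ
  gain w h A = ∑ (λ e → w e * Δ h e A)

  -- The slack of `E-step` as a sum of products: the inductive slacks of both branches, and `w`
  -- times the drop of the expected first marginal from `y` to `z` plus `z` times its value at `z`.
  step-identity : ∀ {y w z d'} a₁ a₀ b₁ b₀ g₁ g₀ d → z ≡ y + w → d' ≡ a₁ - a₀ →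
    (y * a₁ + (1ℚ - y) * a₀) + (z * g₁ + (1ℚ - z) * (w * d + g₀))
      + (z * (b₁ - (a₁ + g₁)) + (1ℚ - z) * (b₀ - (a₀ + g₀)) + w * ((d' - d) + z * d))
    ≡ z * b₁ + (1ℚ - z) * b₀
  step-identity {y} {w} a₁ a₀ b₁ b₀ g₁ g₀ d refl refl =
    solve 9 (λ y w a₁ a₀ b₁ b₀ g₁ g₀ d →
      (y :* a₁ :+ (con 1ℚ :- y) :* a₀) :+ ((y :+ w) :* g₁ :+ (con 1ℚ :- (y :+ w)) :* (w :* d :+ g₀))
      :+ ((y :+ w) :* (b₁ :- (a₁ :+ g₁)) :+ (con 1ℚ :- (y :+ w)) :* (b₀ :- (a₀ :+ g₀)) :+ w :* (((a₁ :- a₀) :- d) :+ (y :+ w) :* d))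
      := (y :+ w) :* b₁ :+ (con 1ℚ :- (y :+ w)) :* b₀) refl y w a₁ a₀ b₁ b₀ g₁ g₀ d
    where open +-*-Solver

  -- Concavity of the multilinear extension along a nonnegative direction w = z - y, with the
  -- derivative at z bounded below by the expected marginals at the random set itself.
  E-step : ∀ {n} {y w z : Fin n → ℚ} → Probability y → Probability z → (∀ i → 0ℚ ≤ w i) → (∀ i → z i ≡ y i + w i) →
           ∀ {h} → (∀ e A → 0ℚ ≤ Δ h e A) → Submodular h → E y h + E z (gain w h) ≤ E z h
  E-step {zero} py pz 0≤w z≡ {h} mono sub = ≤-reflexive (+-identityʳ (h []))
  E-step {suc n} {y} {w} {z} py pz 0≤w z≡ {h} mono sub =
    subst (_≤ E z h) (sym lhs-eq) (slack total 0≤total total-eq)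
    where
    open +-*-Solver
    h₁ = h ∘ (inside ∷_)
    h₀ = h ∘ (outside ∷_)
    y₀ = y zero
    w₀ = w zero
    z₀ = z zero
    y' = y ∘ suc
    w' = w ∘ suc
    z' = z ∘ suc
    D : Subset n → ℚ
    D A = h₁ A - h₀ A
    IH₁ : E y' h₁ + E z' (gain w' h₁) ≤ E z' h₁
    IH₁ = E-step (py ∘ suc) (pz ∘ suc) (0≤w ∘ suc) (z≡ ∘ suc) (λ e A → mono (suc e) (inside ∷ A)) (cons-submodular inside sub)
    IH₀ : E y' h₀ + E z' (gain w' h₀) ≤ E z' h₀
    IH₀ = E-step (py ∘ suc) (pz ∘ suc) (0≤w ∘ suc) (z≡ ∘ suc) (λ e A → mono (suc e) (outside ∷ A)) (cons-submodular outside sub)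
    D-antitone : Antitone D
    D-antitone A⊆B = sub .Δ-antitone zero (out⊆ A⊆B)
    E-D : ∀ p → E p D ≡ E p h₁ - E p h₀
    E-D p = trans (E-cong p (λ A → solve 2 (λ x y → x :- y := con (- 1ℚ) :* y :+ x) refl (h₁ A) (h₀ A)))
      (trans (E-lin p (- 1ℚ) h₀ h₁) (solve 2 (λ x y → con (- 1ℚ) :* y :+ x := x :- y) refl (E p h₁) (E p h₀)))
    y≤z : ∀ i → y i ≤ z i
    y≤z i = slack (w i) (0≤w i) (sym (z≡ i))
    0≤ED : 0ℚ ≤ E z' D
    0≤ED = subst (_≤ E z' D) (E-const z' 0ℚ) (E-mono (pz ∘ suc) (λ A → mono zero (outside ∷ A)))
    -- Submodularity enters here: the marginal of the first element is antitone, so its expectation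
    -- falls as the probabilities grow.
    ED≤ : E z' D ≤ E y' D
    ED≤ = E-antitone (py ∘ suc) (pz ∘ suc) (y≤z ∘ suc) D-antitone
    a₁ = E y' h₁
    a₀ = E y' h₀
    b₁ = E z' h₁
    b₀ = E z' h₀
    g₁ = E z' (gain w' h₁)
    g₀ = E z' (gain w' h₀)
    lhs-eq : E y h + E z (gain w h) ≡
             (y₀ * a₁ + (1ℚ - y₀) * a₀) + (z₀ * g₁ + (1ℚ - z₀) * (w₀ * E z' D + g₀))
    lhs-eq = cong₂ (λ u v → E y h + (z₀ * u + (1ℚ - z₀) * v))
      (E-cong z' (λ A → solve 3 (λ w x g → w :* (x :- x) :+ g := g) refl w₀ (h₁ A) (gain w' h₁ A)))
      (E-lin z' w₀ D (gain w' h₀))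
    total = z₀ * (b₁ - (a₁ + g₁)) + (1ℚ - z₀) * (b₀ - (a₀ + g₀)) + w₀ * ((E y' D - E z' D) + z₀ * E z' D)
    0≤total : 0ℚ ≤ total
    0≤total = +-nonneg (+-nonneg (*-nonneg (proj₁ (pz zero)) (≤⇒0≤- IH₁)) (*-nonneg (≤⇒0≤- (proj₂ (pz zero))) (≤⇒0≤- IH₀)))
      (*-nonneg (0≤w zero) (+-nonneg (≤⇒0≤- ED≤) (*-nonneg (proj₁ (pz zero)) 0≤ED)))
    total-eq : (y₀ * a₁ + (1ℚ - y₀) * a₀) + (z₀ * g₁ + (1ℚ - z₀) * (w₀ * E z' D + g₀)) + total ≡ E z h
    total-eq = step-identity {y₀} {w₀} {z₀} a₁ a₀ b₁ b₀ g₁ g₀ (E z' D) (z≡ zero) (E-D y')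

  -- The point reached after `k` rounds on the ray in direction `w`; consecutive points differ by
  -- exactly `w`, as `E-step` requires.
  scaled : ∀ {n} → ℕ → (Fin n → ℚ) → Fin n → ℚ
  scaled k w e = ι k * w e

  -- Concavity bounds the progress of a round by its value at the end of the round, which is at
  -- least the remaining deficit; hence every round halves the expected deficit.
  deficit-decay : ∀ {n} {w : Fin n → ℚ} {h} a → (∀ e → 0ℚ ≤ w e) → (∀ e A → 0ℚ ≤ Δ h e A) → Submodular h →
                  (∀ A → 0ℚ ≤ h A) → (∀ A → a - h A ≤ gain w h A) →
                  ∀ k → (∀ e → scaled k w e ≤ 1ℚ) → ι (2 ℕ.^ k) * E (scaled k w) (λ A → a - h A) ≤ a
  deficit-decay {n} {w} {h} a 0≤w mono sub 0≤h progress = go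
    where
    open +-*-Solver
    deficit : Subset n → ℚ
    deficit A = a - h A
    0≤scaled : ∀ k e → 0ℚ ≤ scaled k w e
    0≤scaled k e = *-nonneg (ι-nonneg k) (0≤w e)
    scaled-suc : ∀ k e → scaled (suc k) w e ≡ scaled k w e + w e
    scaled-suc k e = trans (cong (_* w e) (ι-+ 1 k))
      (solve 2 (λ k w → (con 1ℚ :+ k) :* w := k :* w :+ w) refl (ι k) (w e))
    deficit≤a : ∀ A → deficit A ≤ a
    deficit≤a A = slack (h A) (0≤h A) (solve 2 (λ a x → a :- x :+ x := a) refl a (h A))
    go : ∀ k → (∀ e → scaled k w e ≤ 1ℚ) → ι (2 ℕ.^ k) * E (scaled k w) deficit ≤ a
    go zero _ = subst (_≤ a) (sym (*-identityˡ _))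
      (subst (E (scaled 0 w) deficit ≤_) (E-const (scaled 0 w) a)
        (E-mono (λ e → 0≤scaled 0 e , subst (_≤ 1ℚ) (sym (*-zeroˡ (w e))) 0≤1) deficit≤a))
    go (suc k) le1 = ≤-trans (subst₂ _≤_ (sym eq) refl
        (*-monoˡ (ι (2 ℕ.^ k)) (ι-nonneg (2 ℕ.^ k)) halve)) (go k le1')
      where
      z = scaled (suc k) w
      y = scaled k w
      le1' : ∀ e → y e ≤ 1ℚ
      le1' e = ≤-trans (slack (w e) (0≤w e) (sym (scaled-suc k e))) (le1 e)
      py : Probability y
      py e = 0≤scaled k e , le1' e
      pz : Probability z
      pz e = 0≤scaled (suc k) e , le1 e
      -- One copy of the deficit at `z` is what remains after the round; the other is a lower bound
      -- for the expected gain at `z`.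
      halve : E z deficit + E z deficit ≤ E y deficit
      halve = slack ((E z h - (E y h + E z (gain w h))) + (E z (gain w h) - E z deficit))
        (+-nonneg (≤⇒0≤- (E-step py pz 0≤w (scaled-suc k) mono sub)) (≤⇒0≤- (E-mono pz progress)))
        halve-eq
        where
        halve-eq : E z deficit + E z deficit + ((E z h - (E y h + E z (gain w h))) + (E z (gain w h) - E z deficit)) ≡ E y deficit
        halve-eq = trans
          (cong (λ t → t + t + ((E z h - (E y h + E z (gain w h))) + (E z (gain w h) - t))) (E-minus z a h))
          (trans (solve 4 (λ a u v g → (a :- u) :+ (a :- u) :+ ((u :- (v :+ g)) :+ (g :- (a :- u))) := a :- v) refl
                    a (E z h) (E y h) (E z (gain w h)))
                 (sym (E-minus y a h)))
      eq : ι (2 ℕ.^ suc k) * E z deficit ≡ ι (2 ℕ.^ k) * (E z deficit + E z deficit)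
      eq = trans (cong (_* E z deficit) (ι-* 2 (2 ℕ.^ k)))
        (solve 2 (λ u x → (con (ι 2) :* u) :* x := u :* (x :+ x)) refl (ι (2 ℕ.^ k)) (E z deficit))

  *-cancelʳ-≡ : ∀ {p q} r → 0ℚ < r → p * r ≡ q * r → p ≡ q
  *-cancelʳ-≡ r 0<r eq = ≤-antisym (*-cancelʳ r 0<r (≤-reflexive eq)) (*-cancelʳ r 0<r (≤-reflexive (sym eq)))

  ι-pos′ : ∀ d .{{_ : ℕ.NonZero d}} → 0ℚ < ι d
  ι-pos′ (suc d) = ι-pos d

  frac-merge : ∀ s m .{{_ : ℕ.NonZero s}} .{{_ : ℕ.NonZero (s ℕ.* m)}} → ι m * (+ 1 / (s ℕ.* m)) ≡ + 1 / s
  frac-merge s m = *-cancelʳ-≡ (ι s) (ι-pos′ s) (begin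
    ι m * u * ι s        ≡⟨ solve 3 (λ m u s → m :* u :* s := u :* (s :* m)) refl (ι m) u (ι s) ⟩
    u * (ι s * ι m)      ≡⟨ cong (u *_) (ι-* s m) ⟨
    u * ι (s ℕ.* m)      ≡⟨ frac-cancel 1 (s ℕ.* m) ⟩
    ι 1                  ≡⟨ frac-cancel 1 s ⟨
    (+ 1 / s) * ι s      ∎)
    where
    open ≡-Reasoning
    open +-*-Solver
    u = + 1 / (s ℕ.* m)

  frac-bound : ∀ k d d' .{{_ : ℕ.NonZero d}} .{{_ : ℕ.NonZero d'}} → k ℕ.* d' ℕ.≤ d → ι k * (+ 1 / d) ≤ + 1 / d'
  frac-bound k d d' kd'≤d = *-cancelʳ (ι d) (ι-pos′ d) (*-cancelʳ (ι d') (ι-pos′ d') (subst₂ _≤_ lhs rhs (ι-mono kd'≤d)))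
    where
    open ≡-Reasoning
    open +-*-Solver
    u = + 1 / d
    v = + 1 / d'
    lhs : ι (k ℕ.* d') ≡ ι k * u * ι d * ι d'
    lhs = begin
      ι (k ℕ.* d')                 ≡⟨ ι-* k d' ⟩
      ι k * ι d'                   ≡⟨ cong (λ x → ι k * x) (*-identityˡ (ι d')) ⟨
      ι k * (ι 1 * ι d')           ≡⟨ cong (λ x → ι k * (x * ι d')) (frac-cancel 1 d) ⟨
      ι k * (u * ι d * ι d')       ≡⟨ solve 4 (λ k u d e → k :* (u :* d :* e) := k :* u :* d :* e) refl (ι k) u (ι d) (ι d') ⟩
      ι k * u * ι d * ι d'         ∎
    rhs : ι d ≡ v * ι d * ι d'
    rhs = begin
      ι d                          ≡⟨ *-identityˡ (ι d) ⟨
      ι 1 * ι d                    ≡⟨ cong (_* ι d) (frac-cancel 1 d') ⟨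
      v * ι d' * ι d               ≡⟨ solve 3 (λ v e d → v :* e :* d := v :* d :* e) refl v (ι d') (ι d) ⟩
      v * ι d * ι d'               ∎

  ι-∸ : ∀ {a b} → b ℕ.≤ a → ι (a ℕ.∸ b) ≡ ι a - ι b
  ι-∸ {a} {b} b≤a = begin
    ι (a ℕ.∸ b)                      ≡⟨ solve 2 (λ x y → x := x :+ y :- y) refl (ι (a ℕ.∸ b)) (ι b) ⟩
    ι (a ℕ.∸ b) + ι b - ι b          ≡⟨ cong (_- ι b) (ι-+ (a ℕ.∸ b) b) ⟨
    ι (a ℕ.∸ b ℕ.+ b) - ι b          ≡⟨ cong (λ x → ι x - ι b) (ℕP.m∸n+n≡m b≤a) ⟩
    ι a - ι b                        ∎
    where
    open ≡-Reasoning
    open +-*-Solver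

-- Finite laws of colors and expectations over colorings.

module ColorLaws where
  open MultilinearExtension
  open import Data.Nat as ℕ using (ℕ; zero; suc; _≡ᵇ_; s≤s)
  import Data.Nat.Properties as ℕP
  open import Data.Nat.Logarithm using (⌈log₂_⌉)
  open import Data.Integer as ℤ using (ℤ)
  import Data.Integer.Properties as ℤP
  open import Data.Rational using (ℚ; 0ℚ; 1ℚ; _/_; _+_; _*_; _-_; -_; _≤_; _<_)
  open import Data.Rational.Properties
  open import Data.Rational.Solver using (module +-*-Solver)
  open import Data.Bool using (Bool; true; false; if_then_else_)
  open import Data.Bool.Properties using (T-≡)
  open import Data.Fin using (Fin; zero; suc)
  open import Data.Fin.Subset using (Subset; outside)
  open import Data.Vec using ([]; _∷_)
  import Data.Vec.Functional as VF
  open import Data.List as List using (List; []; _∷_; map; upTo; filter; length; concatMap; concat; _++_)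
  open import Data.List.Properties using (map-cong; map-++; filter-++; length-++; upTo-∷ʳ; length-upTo)
  open import Data.List.Relation.Unary.Any using (here; there)
  open import Data.List.Membership.Propositional using (_∈_)
  open import Data.List.Membership.Propositional.Properties using (∈-map⁺; ∈-map⁻; ∈-upTo⁺; ∈-concat⁺′; ∈-concat⁻′)
  open import Data.Product using (_×_; _,_)
  open import Function using (_∘_)
  open import Function.Bundles using (Equivalence)
  open import Relation.Nullary using (no; does)
  open import Relation.Binary.PropositionalEquality using (_≡_; refl; sym; trans; cong; cong₂; subst; subst₂; module ≡-Reasoning)

  weigh : (ℕ → ℚ) → ℚ × ℕ → ℚ
  weigh k (w , c) = w * k c

  average : Dist → (ℕ → ℚ) → ℚ
  average L k = sumℚ (map (weigh k) L)

  NonnegWeights : Dist → Set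
  NonnegWeights L = ∀ {w c} → (w , c) ∈ L → 0ℚ ≤ w

  total : Dist → ℚ
  total L = average L (λ _ → 1ℚ)

  indicator : Bool → ℚ
  indicator b = if b then 1ℚ else 0ℚ

  mass : Dist → ℕ → ℚ
  mass L col = average L (λ c → indicator (c ≡ᵇ col))

  average-mono : ∀ {L} → NonnegWeights L → ∀ {k k'} → (∀ c → k c ≤ k' c) → average L k ≤ average L k'
  average-mono {[]} nonneg le = ≤-refl
  average-mono {(w , c) ∷ L} nonneg le = +-mono-≤ (*-monoˡ w (nonneg (here refl)) (le c)) (average-mono (nonneg ∘ there) le)

  average-+ : ∀ L k k' → average L (λ c → k c + k' c) ≡ average L k + average L k'
  average-+ [] k k' = refl
  average-+ ((w , c) ∷ L) k k' = trans (cong (λ t → w * (k c + k' c) + t) (average-+ L k k'))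
    (solve 5 (λ w x y s t → w :* (x :+ y) :+ (s :+ t) := w :* x :+ s :+ (w :* y :+ t)) refl w (k c) (k' c) (average L k) (average L k'))
    where open +-*-Solver

  average-cong : ∀ L {k k'} → (∀ c → k c ≡ k' c) → average L k ≡ average L k'
  average-cong L eq = cong sumℚ (map-cong (λ (w , c) → cong (w *_) (eq c)) L)

  -- Testing for one color sees the law only through the mass of that color. With total mass 1 this
  -- is the coin flip in the recursion of `E`.
  average-bool : ∀ L col (H : Bool → ℚ) → average L (λ c → H (c ≡ᵇ col)) ≡ mass L col * H true + (total L - mass L col) * H false
  average-bool [] col H = solve 2 (λ t f → con 0ℚ := con 0ℚ :* t :+ (con 0ℚ :- con 0ℚ) :* f) refl (H true) (H false)
    where open +-*-Solver
  average-bool ((w , c) ∷ L) col H = trans (cong (λ t → w * H (c ≡ᵇ col) + t) (average-bool L col H)) (add (c ≡ᵇ col))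
    where
    open +-*-Solver
    m = mass L col
    t = total L
    add : ∀ b → w * H b + (m * H true + (t - m) * H false) ≡
                (w * indicator b + m) * H true + ((w * 1ℚ + t) - (w * indicator b + m)) * H false
    add true = solve 5 (λ w m t x y → w :* x :+ (m :* x :+ (t :- m) :* y)
      := (w :* con 1ℚ :+ m) :* x :+ ((w :* con 1ℚ :+ t) :- (w :* con 1ℚ :+ m)) :* y) refl w m t (H true) (H false)
    add false = solve 5 (λ w m t x y → w :* y :+ (m :* x :+ (t :- m) :* y)
      := (w :* con 0ℚ :+ m) :* x :+ ((w :* con 1ℚ :+ t) :- (w :* con 0ℚ :+ m)) :* y) refl w m t (H true) (H false)

  indicator-nonneg : ∀ b → 0ℚ ≤ indicator b
  indicator-nonneg true = 0≤1
  indicator-nonneg false = ≤-refl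

  average-nonneg : ∀ {L} → NonnegWeights L → ∀ {k} → (∀ c → 0ℚ ≤ k c) → 0ℚ ≤ average L k
  average-nonneg {[]} nonneg 0≤k = ≤-refl
  average-nonneg {(w , c) ∷ L} nonneg 0≤k = +-nonneg (*-nonneg (nonneg (here refl)) (0≤k c)) (average-nonneg (nonneg ∘ there) 0≤k)

  mass≤total : ∀ {L} col → NonnegWeights L → mass L col ≤ total L
  mass≤total col nonneg = average-mono nonneg (λ c → indicator≤1 (c ≡ᵇ col))
    where
    indicator≤1 : ∀ b → indicator b ≤ 1ℚ
    indicator≤1 true = ≤-refl
    indicator≤1 false = 0≤1

  ≡ᵇ-refl : ∀ c → (c ≡ᵇ c) ≡ true
  ≡ᵇ-refl c = Equivalence.to T-≡ (ℕP.≡⇒≡ᵇ c c refl)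

  weight≤mass : ∀ {L w col} → NonnegWeights L → (w , col) ∈ L → w ≤ mass L col
  weight≤mass {(w , col) ∷ L} nonneg (here refl) = subst (_≤ mass ((w , col) ∷ L) col) (trans (+-identityʳ _)
      (trans (cong (λ b → w * indicator b) (≡ᵇ-refl col)) (*-identityʳ w)))
    (+-monoʳ-≤ (w * indicator (col ≡ᵇ col)) (average-nonneg {L} (nonneg ∘ there) (λ c → indicator-nonneg (c ≡ᵇ col))))
  weight≤mass {(w' , c') ∷ L} {w} {col} nonneg (there w∈) = ≤-trans (weight≤mass (nonneg ∘ there) w∈)
    (subst (_≤ w' * indicator (c' ≡ᵇ col) + mass L col) (+-identityˡ _)
      (+-monoˡ-≤ (mass L col) (*-nonneg (nonneg (here refl)) (indicator-nonneg (c' ≡ᵇ col)))))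

  -- Replaces the pattern-matching function inside `expect` by `weigh`, so that the lemmas on
  -- `average` apply.
  expect-suc : ∀ {n} (ds : Fin (suc n) → Dist) g →
               expect ds g ≡ average (ds zero) (λ c → expect (ds ∘ suc) (λ C → g (c VF.∷ C)))
  expect-suc ds g = cong sumℚ (map-cong (λ { (w , c) → refl }) (ds zero))

  expect-mono : ∀ {n} (ds : Fin n → Dist) → (∀ i → NonnegWeights (ds i)) → ∀ {g g'} → (∀ C → g C ≤ g' C) → expect ds g ≤ expect ds g'
  expect-mono {zero} ds nonneg le = le (λ ())
  expect-mono {suc n} ds nonneg {g} {g'} le = subst₂ _≤_ (sym (expect-suc ds g)) (sym (expect-suc ds g'))
    (average-mono (nonneg zero) (λ c → expect-mono (ds ∘ suc) (nonneg ∘ suc) (λ C → le (c VF.∷ C))))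

  expect-+ : ∀ {n} (ds : Fin n → Dist) g g' → expect ds (λ C → g C + g' C) ≡ expect ds g + expect ds g'
  expect-+ {zero} ds g g' = refl
  expect-+ {suc n} ds g g' = begin
    expect ds (λ C → g C + g' C)           ≡⟨ expect-suc ds (λ C → g C + g' C) ⟩
    average (ds zero) (λ c → expect (ds ∘ suc) (λ C → g (c VF.∷ C) + g' (c VF.∷ C)))
      ≡⟨ average-cong (ds zero) (λ c → expect-+ (ds ∘ suc) (λ C → g (c VF.∷ C)) (λ C → g' (c VF.∷ C))) ⟩
    average (ds zero) (λ c → u c + u' c)   ≡⟨ average-+ (ds zero) u u' ⟩
    average (ds zero) u + average (ds zero) u'     ≡⟨ cong₂ _+_ (expect-suc ds g) (expect-suc ds g') ⟨
    expect ds g + expect ds g'             ∎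
    where
    open ≡-Reasoning
    u u' : ℕ → ℚ
    u c = expect (ds ∘ suc) (λ C → g (c VF.∷ C))
    u' c = expect (ds ∘ suc) (λ C → g' (c VF.∷ C))

  average-zero : ∀ L → average L (λ _ → 0ℚ) ≡ 0ℚ
  average-zero [] = refl
  average-zero ((w , c) ∷ L) = trans (cong₂ _+_ (*-zeroʳ w) (average-zero L)) (+-identityˡ 0ℚ)

  expect-zero : ∀ {n} (ds : Fin n → Dist) → expect ds (λ _ → 0ℚ) ≡ 0ℚ
  expect-zero {zero} ds = refl
  expect-zero {suc n} ds = trans (expect-suc ds (λ _ → 0ℚ))
    (trans (average-cong (ds zero) (λ _ → expect-zero (ds ∘ suc))) (average-zero (ds zero)))

  expect-nonneg : ∀ {n} (ds : Fin n → Dist) → (∀ i → NonnegWeights (ds i)) → ∀ {g} → (∀ C → 0ℚ ≤ g C) → 0ℚ ≤ expect ds g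
  expect-nonneg {zero} ds nonneg 0≤g = 0≤g (λ ())
  expect-nonneg {suc n} ds nonneg {g} 0≤g = subst (0ℚ ≤_) (sym (expect-suc ds g))
    (average-nonneg (nonneg zero) (λ c → expect-nonneg (ds ∘ suc) (nonneg ∘ suc) (λ C → 0≤g (c VF.∷ C))))

  -- A single color class is a product random subset.
  expect-colorClass : ∀ {n} (ds : Fin n → Dist) → (∀ i → total (ds i) ≡ 1ℚ) → ∀ col h →
                      expect ds (λ C → h (colorClass C col)) ≡ E (λ i → mass (ds i) col) h
  expect-colorClass {zero} ds total≡1 col h = refl
  expect-colorClass {suc n} ds total≡1 col h = begin
    expect ds (λ C → h (colorClass C col))        ≡⟨ expect-suc ds (λ C → h (colorClass C col)) ⟩
    average (ds zero) (λ c → expect (ds ∘ suc) (λ C → h ((c ≡ᵇ col) ∷ colorClass C col)))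
      ≡⟨ average-cong (ds zero) (λ c → expect-colorClass (ds ∘ suc) (total≡1 ∘ suc) col (h ∘ ((c ≡ᵇ col) ∷_))) ⟩
    average (ds zero) (λ c → H (c ≡ᵇ col))        ≡⟨ average-bool (ds zero) col H ⟩
    m * H true + (total (ds zero) - m) * H false  ≡⟨ cong (λ t → m * H true + (t - m) * H false) (total≡1 zero) ⟩
    m * H true + (1ℚ - m) * H false               ∎
    where
    open ≡-Reasoning
    m = mass (ds zero) col
    H : Bool → ℚ
    H b = E (λ i → mass (ds (suc i)) col) (h ∘ (b ∷_))

  -- The share of one of `s` equally likely guesses, for a given palette size. An empty palette
  -- sends the whole share to the discard color 0.
  uniformColor : (s : ℕ) .{{_ : ℕ.NonZero s}} → ℕ → Dist
  uniformColor s zero = ((ℤ.+ 1) / s , 0) ∷ []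
  uniformColor (suc s) (suc m) = map (λ col → ((ℤ.+ 1) / (suc s ℕ.* suc m) , suc col)) (upTo (suc m))

  guess : ℕ → ℕ → ℕ → ℤ
  guess c ℓ j = (ℤ.+ (ℓ ℕ.+ j)) ℤ.- (ℤ.+ (3 ℕ.* c))

  round : ℕ → (ℤ → ℕ) → ℕ → ℕ → Dist
  round r K qt j = uniformColor (suc (6 ℕ.* ⌈log₂ r ⌉)) (K (guess ⌈log₂ r ⌉ ⌈log₂ qt ⌉ j))

  rounds : ℕ → List ℕ
  rounds r = upTo (suc (6 ℕ.* ⌈log₂ r ⌉))

  -- The local function perR of alg1Law has no name outside Defs: the left-hand side _ of
  -- perR-uniform is solved by its use in alg1Law-uniform.
  mutual
    alg1Law-uniform : ∀ r K qt → alg1Law r K qt ≡ concatMap (round r K qt) (rounds r)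
    alg1Law-uniform r K qt = cong concat (map-cong (perR-uniform r K qt) (rounds r))

    perR-uniform : ∀ r K qt j → _ ≡ round r K qt j
    perR-uniform r K qt j with K (guess ⌈log₂ r ⌉ ⌈log₂ qt ⌉ j)
    ... | zero = refl
    ... | suc m = refl

  average-++ : ∀ L L' k → average (L ++ L') k ≡ average L k + average L' k
  average-++ [] L' k = sym (+-identityˡ _)
  average-++ (x ∷ L) L' k = trans (cong (λ t → weigh k x + t) (average-++ L L' k)) (sym (+-assoc (weigh k x) _ _))

  average-concatMap : ∀ (F : ℕ → Dist) k {a} → (∀ j → average (F j) k ≡ a) → ∀ js → average (concatMap F js) k ≡ ι (length js) * a
  average-concatMap F k {a} eq [] = sym (*-zeroˡ a)
  average-concatMap F k {a} eq (j ∷ js) = begin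
    average (F j ++ concatMap F js) k        ≡⟨ average-++ (F j) (concatMap F js) k ⟩
    average (F j) k + average (concatMap F js) k     ≡⟨ cong₂ _+_ (eq j) (average-concatMap F k eq js) ⟩
    a + ι (length js) * a                    ≡⟨ solve 2 (λ a l → a :+ l :* a := (con 1ℚ :+ l) :* a) refl a (ι (length js)) ⟩
    (ι 1 + ι (length js)) * a                ≡⟨ cong (_* a) (ι-+ 1 (length js)) ⟨
    ι (suc (length js)) * a                  ∎
    where
    open ≡-Reasoning
    open +-*-Solver

  uniform-total : ∀ s m → total (uniformColor (suc s) m) ≡ (ℤ.+ 1) / suc s
  uniform-total s zero = trans (+-identityʳ _) (*-identityʳ _)
  uniform-total s (suc m) = begin
    average (map (λ col → (u , suc col)) (upTo (suc m))) (λ _ → 1ℚ)     ≡⟨ go (upTo (suc m)) ⟩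
    ι (length (upTo (suc m))) * u            ≡⟨ cong (λ l → ι l * u) (length-upTo (suc m)) ⟩
    ι (suc m) * u                            ≡⟨ frac-merge (suc s) (suc m) ⟩
    (ℤ.+ 1) / suc s                          ∎
    where
    open ≡-Reasoning
    open +-*-Solver
    u = (ℤ.+ 1) / (suc s ℕ.* suc m)
    go : ∀ cols → average (map (λ col → (u , suc col)) cols) (λ _ → 1ℚ) ≡ ι (length cols) * u
    go [] = sym (*-zeroˡ u)
    go (x ∷ cols) = trans (cong (λ t → u * 1ℚ + t) (go cols))
      (trans (solve 2 (λ a l → a :* con 1ℚ :+ l :* a := (con 1ℚ :+ l) :* a) refl u (ι (length cols))) (cong (_* u) (sym (ι-+ 1 (length cols)))))

  uniform-nonneg : ∀ s m → NonnegWeights (uniformColor (suc s) m)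
  uniform-nonneg s zero (here refl) = frac-nonneg 1 (suc s)
  uniform-nonneg s (suc m) w∈ with ∈-map⁻ (λ col → ((ℤ.+ 1) / (suc s ℕ.* suc m) , suc col)) w∈
  ... | _ , _ , refl = frac-nonneg 1 (suc s ℕ.* suc m)

  alg1-total : ∀ r K qt → total (alg1Law r K qt) ≡ 1ℚ
  alg1-total r K qt = begin
    total (alg1Law r K qt)                       ≡⟨ cong total (alg1Law-uniform r K qt) ⟩
    total (concatMap (round r K qt) (rounds r))  ≡⟨ average-concatMap (round r K qt) (λ _ → 1ℚ) (λ j → uniform-total (6 ℕ.* ⌈log₂ r ⌉) (K (guess ⌈log₂ r ⌉ ⌈log₂ qt ⌉ j))) (rounds r) ⟩
    ι (length (rounds r)) * ((ℤ.+ 1) / s)        ≡⟨ cong (λ l → ι l * ((ℤ.+ 1) / s)) (length-upTo s) ⟩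
    ι s * ((ℤ.+ 1) / s)                          ≡⟨ *-comm (ι s) ((ℤ.+ 1) / s) ⟩
    ((ℤ.+ 1) / s) * ι s                          ≡⟨ frac-cancel 1 s ⟩
    1ℚ                                           ∎
    where
    open ≡-Reasoning
    s = suc (6 ℕ.* ⌈log₂ r ⌉)

  alg1-nonneg : ∀ r K qt → NonnegWeights (alg1Law r K qt)
  alg1-nonneg r K qt {w} {c} w∈ with ∈-concat⁻′ (map (round r K qt) (rounds r)) (subst ((w , c) ∈_) (alg1Law-uniform r K qt) w∈)
  ... | L , w∈L , L∈ with ∈-map⁻ (round r K qt) L∈
  ... | j , _ , refl = uniform-nonneg (6 ℕ.* ⌈log₂ r ⌉) (K (guess ⌈log₂ r ⌉ ⌈log₂ qt ⌉ j)) w∈L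

  -- The index `j = L + 3c - ℓ` makes the guess equal to `L`; the two inequalities place it in the
  -- window. The entry for this guess and color alone gives the bound.
  alg1-mass : ∀ r K qt {L col k} → K (ℤ.+ L) ≡ suc k → col ℕ.< suc k →
              ⌈log₂ qt ⌉ ℕ.≤ L ℕ.+ 3 ℕ.* ⌈log₂ r ⌉ → L ℕ.≤ ⌈log₂ qt ⌉ ℕ.+ 3 ℕ.* ⌈log₂ r ⌉ →
              (ℤ.+ 1) / (suc (6 ℕ.* ⌈log₂ r ⌉) ℕ.* suc k) ≤ mass (alg1Law r K qt) (suc col)
  alg1-mass r K qt {L} {col} {k} K≡ col<k ℓ≤ L≤ = weight≤mass (alg1-nonneg r K qt)
    (subst ((u , suc col) ∈_) (sym (alg1Law-uniform r K qt))
      (∈-concat⁺′ {vs = round r K qt j} {xss = map (round r K qt) (rounds r)}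
        (subst (λ m → (u , suc col) ∈ uniformColor s m) (sym (trans (cong K guess≡) K≡))
          (∈-map⁺ (λ col → (u , suc col)) (∈-upTo⁺ col<k)))
        (∈-map⁺ (round r K qt) (∈-upTo⁺ j<s))))
    where
    open import Data.Nat.Solver renaming (module +-*-Solver to ℕ-Solver)
    open ℕ-Solver
    c = ⌈log₂ r ⌉
    ℓ = ⌈log₂ qt ⌉
    s = suc (6 ℕ.* c)
    u = (ℤ.+ 1) / (s ℕ.* suc k)
    j = L ℕ.+ 3 ℕ.* c ℕ.∸ ℓ
    j<s : j ℕ.< s
    j<s = s≤s (ℕP.m≤n+o⇒m∸n≤o _ ℓ (ℕP.≤-trans (ℕP.+-monoˡ-≤ (3 ℕ.* c) L≤)
      (ℕP.≤-reflexive (solve 2 (λ l c → l :+ con 3 :* c :+ con 3 :* c := l :+ con 6 :* c) refl ℓ c))))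
    guess≡ : guess c ℓ j ≡ ℤ.+ L
    guess≡ = trans (cong (λ t → ℤ.+ t ℤ.- ℤ.+ (3 ℕ.* c)) (ℕP.m+[n∸m]≡n ℓ≤))
      (trans (ℤP.m-n≡m⊖n (L ℕ.+ 3 ℕ.* c) (3 ℕ.* c)) (trans (ℤP.⊖-≥ (ℕP.m≤n+m (3 ℕ.* c) L)) (cong ℤ.+_ (ℕP.m+n∸n≡m L (3 ℕ.* c)))))

  -- The cutoff `k` is fixed in advance, whereas `maxColor` varies with the random coloring; this
  -- makes linearity of expectation available.
  baseColorsUpTo : ∀ {n} → (Subset n → ℕ) → Coloring n → ℕ → ℕ
  baseColorsUpTo f C k = length (filter (λ c → f (colorClass C c) ℕ.≟ f Data.Fin.Subset.⊤) (map suc (upTo k)))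

  bit : Bool → ℕ
  bit b = if b then 1 else 0

  isBase : ∀ {n} → (Subset n → ℕ) → Subset n → Bool
  isBase f A = does (f A ℕ.≟ f Data.Fin.Subset.⊤)

  baseColors-suc : ∀ {n} (f : Subset n → ℕ) C k →
                   baseColorsUpTo f C (suc k) ≡ baseColorsUpTo f C k ℕ.+ bit (isBase f (colorClass C (suc k)))
  baseColors-suc f C k = begin
    length (filter P? (map suc (upTo (suc k))))                              ≡⟨ cong (λ l → length (filter P? (map suc l))) (upTo-∷ʳ k) ⟨
    length (filter P? (map suc (upTo k List.∷ʳ k)))                          ≡⟨ cong (λ l → length (filter P? l)) (map-++ suc (upTo k) (k ∷ [])) ⟩
    length (filter P? (map suc (upTo k) ++ suc k ∷ []))                      ≡⟨ cong length (filter-++ P? (map suc (upTo k)) (suc k ∷ [])) ⟩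
    length (filter P? (map suc (upTo k)) ++ filter P? (suc k ∷ []))          ≡⟨ length-++ (filter P? (map suc (upTo k))) ⟩
    baseColorsUpTo f C k ℕ.+ length (filter P? (suc k ∷ []))                 ≡⟨ cong (baseColorsUpTo f C k ℕ.+_) single ⟩
    baseColorsUpTo f C k ℕ.+ bit (isBase f (colorClass C (suc k)))           ∎
    where
    open ≡-Reasoning
    P? = λ c → f (colorClass C c) ℕ.≟ f Data.Fin.Subset.⊤
    single : length (filter P? (suc k ∷ [])) ≡ bit (isBase f (colorClass C (suc k)))
    single with does (P? (suc k))
    ... | true = refl
    ... | false = refl

-- Probability that a color class is a base.

module ClassProbabilities where
  open MultilinearExtension
  open Quotients using (module Polymatroid; module Diminishing; marginal; when; <ᵇ-true; <ᵇ-false⁻)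
  open Palettes
  open ColorLaws
  open import Data.Nat as ℕ using (ℕ; zero; suc; _≡ᵇ_; s≤s; z≤n)
  import Data.Nat.Properties as ℕP
  open import Data.Nat.Logarithm using (⌈log₂_⌉)
  open import Data.Integer as ℤ using (ℤ)
  open import Data.Rational using (ℚ; 0ℚ; 1ℚ; _/_; _+_; _*_; _-_; -_; _≤_; _<_)
  open import Data.Rational.Properties
  open import Data.Rational.Solver using (module +-*-Solver)
  open import Data.Bool using (Bool; true; false; not)
  open import Data.Fin using (Fin; zero; suc)
  open import Data.Fin.Subset using (Subset; ⊥; ⊤)
  open import Data.Vec using (_∷_)
  open import Data.Product using (_,_; proj₂)
  open import Function using (_∘_)
  open import Relation.Nullary using (¬_; contradiction; yes; no; does; Dec)
  open import Relation.Nullary.Decidable using (dec-true; dec-false)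
  open import Relation.Binary.PropositionalEquality using (_≡_; refl; sym; trans; cong; cong₂; subst; subst₂)
  open import Algebra.Bundles using (CommutativeRing)
  open import Algebra.Properties.CommutativeMonoid.Sum +-0-commutativeMonoid using () renaming (sum to ∑)
  open import Algebra.Properties.Semiring.Sum (CommutativeRing.semiring +-*-commutativeRing) using (*-distribˡ-sum)
  open import Algebra.Properties.CommutativeMonoid.Sum ℕP.+-0-commutativeMonoid using (sum)

  color≤maxColor : ∀ {n} (C : Coloring n) i → C i ℕ.≤ maxColor C
  color≤maxColor C zero = ℕP.m≤m⊔n (C zero) _
  color≤maxColor C (suc i) = ℕP.≤-trans (color≤maxColor (C ∘ suc) i) (ℕP.m≤n⊔m (C zero) _)

  colorClass-empty : ∀ {n} (C : Coloring n) c → (∀ i → C i ℕ.< c) → colorClass C c ≡ ⊥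
  colorClass-empty {zero} C c lt = refl
  colorClass-empty {suc n} C c lt = cong₂ _∷_ (≢⇒≡ᵇ (ℕP.<⇒≢ (lt zero))) (colorClass-empty (C ∘ suc) c (lt ∘ suc))
    where
    ≢⇒≡ᵇ : ∀ {a b} → ¬ a ≡ b → (a ≡ᵇ b) ≡ false
    ≢⇒≡ᵇ {a} {b} a≢b = dec-false (a ℕ.≟ b) a≢b

  module _ {n} (f : Subset n → ℕ) (C : Coloring n) where

    baseColors-mono : ∀ {k m} → k ℕ.≤ m → baseColorsUpTo f C k ℕ.≤ baseColorsUpTo f C m
    baseColors-mono = go ∘ ℕP.≤⇒≤′
      where
      go : ∀ {k m} → k ℕ.≤′ m → baseColorsUpTo f C k ℕ.≤ baseColorsUpTo f C m
      go (ℕ.≤′-reflexive refl) = ℕP.≤-refl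
      go (ℕ.≤′-step {m} k≤m) = ℕP.≤-trans (go k≤m) (ℕP.≤-trans (ℕP.m≤m+n _ _) (ℕP.≤-reflexive (sym (baseColors-suc f C m))))

    -- Colors above `maxColor` have an empty class, which is no base, so a cutoff beyond the maximum
    -- counts nothing extra.
    baseColors≤numBaseColors : ¬ f ⊥ ≡ f ⊤ → ∀ k → baseColorsUpTo f C k ℕ.≤ numBaseColors f C
    baseColors≤numBaseColors ¬base zero = z≤n
    baseColors≤numBaseColors ¬base (suc k) with suc k ℕ.≤? maxColor C
    ... | yes k<max = baseColors-mono k<max
    ... | no k≮max = ℕP.≤-trans (ℕP.≤-reflexive (trans (baseColors-suc f C k) (trans (cong (baseColorsUpTo f C k ℕ.+_) unused) (ℕP.+-identityʳ _))))
                       (baseColors≤numBaseColors ¬base k)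
      where
      unused : bit (isBase f (colorClass C (suc k))) ≡ 0
      unused = cong bit (dec-false (f (colorClass C (suc k)) ℕ.≟ f ⊤)
        (subst (λ S → ¬ f S ≡ f ⊤) (sym (colorClass-empty C (suc k) (λ i → s≤s (ℕP.≤-trans (color≤maxColor C i) (ℕP.≮⇒≥ k≮max))))) ¬base))

    all-baseColors : ∀ k → (∀ col → col ℕ.< k → f (colorClass C (suc col)) ≡ f ⊤) → k ℕ.≤ baseColorsUpTo f C k
    all-baseColors zero _ = z≤n
    all-baseColors (suc k) base = subst (suc k ℕ.≤_) (sym (baseColors-suc f C k))
      (ℕP.≤-trans (ℕP.≤-reflexive (ℕP.+-comm 1 k))
        (ℕP.+-mono-≤ (all-baseColors k (λ col col<k → base col (ℕP.m≤n⇒m≤1+n col<k)))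
          (ℕP.≤-reflexive (sym (cong bit (dec-true (f (colorClass C (suc k)) ℕ.≟ f ⊤) (base k ℕP.≤-refl)))))))

  -- Linearity of expectation over the colors; the factor `a` stands for the reciprocal of the
  -- success probability and avoids division.
  expect-baseColors : ∀ {n} (f : Subset n → ℕ) (ds : Fin n → Dist) → (∀ i → NonnegWeights (ds i)) → ∀ a k →
    (∀ col → col ℕ.< k → 1ℚ ≤ a * expect ds (λ C → ι (bit (isBase f (colorClass C (suc col)))))) →
    ι k ≤ a * expect ds (λ C → ι (baseColorsUpTo f C k))
  expect-baseColors f ds nonneg a zero _ = ≤-reflexive (sym (trans (cong (a *_) (expect-zero ds)) (*-zeroʳ a)))
  expect-baseColors f ds nonneg a (suc k) likely = subst₂ _≤_ (trans (+-comm (ι k) 1ℚ) (sym (ι-+ 1 k))) (sym eq)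
    (+-mono-≤ (expect-baseColors f ds nonneg a k (λ col col<k → likely col (ℕP.m≤n⇒m≤1+n col<k))) (likely k ℕP.≤-refl))
    where
    old new : Coloring _ → ℚ
    old C = ι (baseColorsUpTo f C k)
    new C = ι (bit (isBase f (colorClass C (suc k))))
    split : ∀ C → ι (baseColorsUpTo f C (suc k)) ≡ old C + new C
    split C = trans (cong ι (baseColors-suc f C k)) (ι-+ (baseColorsUpTo f C k) (bit (isBase f (colorClass C (suc k)))))
    eq : a * expect ds (λ C → ι (baseColorsUpTo f C (suc k))) ≡ a * expect ds old + a * expect ds new
    -- Pointwise equal integrands are compared by monotonicity in both directions.
    eq = trans (cong (a *_) (trans (≤-antisym (expect-mono ds nonneg (λ C → ≤-reflexive (split C))) (expect-mono ds nonneg (λ C → ≤-reflexive (sym (split C)))))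
           (expect-+ ds old new))) (*-distribˡ-+ a _ _)

  ι-sum : ∀ {n} (g : Fin n → ℕ) → ι (sum g) ≡ ∑ (λ i → ι (g i))
  ι-sum {zero} g = refl
  ι-sum {suc n} g = trans (ι-+ (g zero) (sum (g ∘ suc))) (cong (ι (g zero) +_) (ι-sum (g ∘ suc)))

  -- The flag is true for small elements, all of whose guesses lie below the level; they are
  -- ignored.
  rate : Bool → ℕ → ℚ
  rate true L = 0ℚ
  rate false L = ((ℤ.+ 1) / (2 ℕ.^ L)) {{ℕP.m^n≢0 2 L}}

  rate-nonneg : ∀ b L → 0ℚ ≤ rate b L
  rate-nonneg true L = ≤-refl
  rate-nonneg false L = frac-nonneg 1 (2 ℕ.^ L) {{ℕP.m^n≢0 2 L}}

  2^-pos : ∀ L → 0ℚ < ι (2 ℕ.^ L)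
  2^-pos L = ι-pos′ (2 ℕ.^ L) {{ℕP.m^n≢0 2 L}}

  -- The level bound is conditional on `0 < m` because `progress` supplies it for active elements,
  -- those of positive marginal.
  rate-marginal : ∀ b {L R} m → (0 ℕ.< m → L ℕ.≤ R) → ι (when (not b) m) ≤ ι (2 ℕ.^ R) * (rate b L * ι m)
  rate-marginal true {L} {R} m _ = *-nonneg (ι-nonneg (2 ℕ.^ R)) (*-nonneg ≤-refl (ι-nonneg m))
  rate-marginal false {L} {R} zero _ = *-nonneg (ι-nonneg (2 ℕ.^ R)) (*-nonneg (rate-nonneg false L) ≤-refl)
  rate-marginal false {L} {R} m@(suc _) L≤R = subst₂ _≤_ (*-identityˡ (ι m)) (*-assoc (ι (2 ℕ.^ R)) (rate false L) (ι m))
    (*-monoʳ {1ℚ} {ι (2 ℕ.^ R) * rate false L} (ι m) (ι-nonneg m) 1≤)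
    where
    eq : ι (2 ℕ.^ R) * rate false L * ι (2 ℕ.^ L) ≡ ι (2 ℕ.^ R)
    eq = trans (*-assoc (ι (2 ℕ.^ R)) (rate false L) (ι (2 ℕ.^ L)))
      (trans (cong (ι (2 ℕ.^ R) *_) (frac-cancel 1 (2 ℕ.^ L) {{ℕP.m^n≢0 2 L}})) (*-identityʳ (ι (2 ℕ.^ R))))
    1≤ : 1ℚ ≤ ι (2 ℕ.^ R) * rate false L
    1≤ = *-cancelʳ {1ℚ} {ι (2 ℕ.^ R) * rate false L} (ι (2 ℕ.^ L)) (2^-pos L)
      (subst₂ _≤_ (sym (*-identityˡ (ι (2 ℕ.^ L)))) (sym eq) (ι-mono {2 ℕ.^ L} {2 ℕ.^ R} (ℕP.^-monoʳ-≤ 2 (L≤R (s≤s z≤n)))))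

  module BaseProbability {n} {f : Subset n → ℕ} (P : IsPolymatroid f) (2≤r : 2 ℕ.≤ f ⊤)
           {q : Fin n → ℕ} (q-min : ∀ i → IsMinQuotientSize f i (q i))
           {K : ℤ → ℕ} (K-size : ∀ R → PaletteSize (f ⊤) R (K R))
           {o} (B : Fin o → Subset n) (disjoint : PairwiseDisjoint B) (base : ∀ i → IsBase f (B i))
           {R} (R-low : 2 ℕ.* 2 ℕ.^ R ℕ.≤ o) where
    open Polymatroid P
    open Palette 2≤r
    open IsPolymatroid P
    open +-*-Solver

    r : ℕ
    r = f ⊤

    ℓ : Fin n → ℕ
    ℓ e = ⌈log₂ q e ⌉

    open Levels q-min B disjoint base {R = R} 1≤c r≤2^c R-low {ℓ = ℓ}
           (λ e → n≤2^⌈log₂n⌉ (q e)) (λ e → 2^⌈log₂n⌉≤2n (q-positive q-min e))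

    law : Fin n → Dist
    law e = alg1Law r K (q e)

    h : Subset n → ℚ
    h A = ι (f A)

    w : Fin n → ℚ
    w e = rate (small e) (level e)

    0≤w : ∀ e → 0ℚ ≤ w e
    0≤w e = rate-nonneg (small e) (level e)

    Δ-marginal : ∀ e A → Δ h e A ≡ ι (marginal f e A)
    Δ-marginal e A = sym (ι-∸ (diminishing .Diminishing.increasing e A))

    h-increasing : ∀ e A → 0ℚ ≤ Δ h e A
    h-increasing e A = subst (0ℚ ≤_) (sym (Δ-marginal e A)) (ι-nonneg (marginal f e A))

    h-submodular : Submodular h
    h-submodular .Submodular.Δ-antitone e {A} {A'} A⊆A' = subst₂ _≤_ (sym (Δ-marginal e A')) (sym (Δ-marginal e A))
      (ι-mono {marginal f e A'} {marginal f e A} (Diminishing.marginal-antitone diminishing e A⊆A'))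

    -- Divides `progress` by `2 ^ R'`. The exponent depends on `A`, while the rates `w` do not, so
    -- one direction serves all sets.
    h-progress : ∀ A → ι r - h A ≤ gain w h A
    h-progress A with progress A
    ... | R' , bound , le = *-cancelʳ (ι (2 ℕ.^ R')) (2^-pos R') (begin
      (ι r - h A) * ι (2 ℕ.^ R')                        ≡⟨ cong (_* ι (2 ℕ.^ R')) (ι-∸ (f≤rank A)) ⟨
      ι (r ℕ.∸ f A) * ι (2 ℕ.^ R')                      ≡⟨ ι-* (r ℕ.∸ f A) (2 ℕ.^ R') ⟨
      ι ((r ℕ.∸ f A) ℕ.* 2 ℕ.^ R')                      ≤⟨ ι-mono {(r ℕ.∸ f A) ℕ.* 2 ℕ.^ R'} {sum large} le ⟩
      ι (sum large)                                     ≡⟨ ι-sum large ⟩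
      ∑ (λ e → ι (large e))                             ≤⟨ ∑-mono each ⟩
      ∑ (λ e → ι (2 ℕ.^ R') * (w e * Δ h e A))          ≡⟨ *-distribˡ-sum (ι (2 ℕ.^ R')) (λ e → w e * Δ h e A) ⟨
      ι (2 ℕ.^ R') * gain w h A                         ≡⟨ *-comm (ι (2 ℕ.^ R')) (gain w h A) ⟩
      gain w h A * ι (2 ℕ.^ R')                         ∎)
      where
      open ≤-Reasoning
      large : Fin n → ℕ
      large e = when (not (small e)) (marginal f e A)
      each : ∀ e → ι (large e) ≤ ι (2 ℕ.^ R') * (w e * Δ h e A)
      each e = subst (λ x → ι (large e) ≤ ι (2 ℕ.^ R') * (w e * x)) (sym (Δ-marginal e A))
        (rate-marginal (small e) {level e} {R'} (marginal f e A)
          (λ 0<m → bound e (<ᵇ-true {f A} (ℕP.m∸n≢0⇒n<m (ℕP.>⇒≢ 0<m)))))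

    -- Small elements have rate 0. For the others the level lies in the guessing window, its palette
    -- contains `col` since palettes grow with the exponent, and `palette-weight` compares the
    -- probabilities.
    rate≤mass : ∀ {col} → col ℕ.< K (ℤ.+ R) → ∀ e → scaled (suc c) w e ≤ mass (law e) (suc col)
    rate≤mass {col} col<K e = go (small e) refl
      where
      0≤mass : 0ℚ ≤ mass (law e) (suc col)
      0≤mass = average-nonneg (alg1-nonneg r K (q e)) (λ c → indicator-nonneg (c ≡ᵇ suc col))
      go : ∀ b → small e ≡ b → ι (suc c) * rate b (level e) ≤ mass (law e) (suc col)
      go true _ = subst (_≤ mass (law e) (suc col)) (sym (*-zeroʳ (ι (suc c)))) 0≤mass
      go false large = at-level (K (ℤ.+ level e)) refl
        where
        ℓ≤ : ℓ e ℕ.≤ level e ℕ.+ 3 ℕ.* c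
        ℓ≤ = ℕP.≤-trans (ℕP.m≤n+m∸n (ℓ e) (3 ℕ.* c)) (ℕP.≤-trans (ℕP.≤-reflexive (ℕP.+-comm (3 ℕ.* c) (ℓ e ℕ.∸ 3 ℕ.* c))) (ℕP.+-monoˡ-≤ (3 ℕ.* c) (ℕP.m≤n⊔m R (ℓ e ℕ.∸ 3 ℕ.* c))))
        lev≤ : level e ℕ.≤ ℓ e ℕ.+ 3 ℕ.* c
        lev≤ = ℕP.⊔-lub (<ᵇ-false⁻ {ℓ e ℕ.+ 3 ℕ.* c} {R} large) (ℕP.≤-trans (ℕP.m∸n≤m (ℓ e) (3 ℕ.* c)) (ℕP.m≤m+n (ℓ e) (3 ℕ.* c)))
        K≤ : ∀ {m} → K (ℤ.+ level e) ≡ m → K (ℤ.+ R) ℕ.≤ m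
        K≤ K≡ = subst (K (ℤ.+ R) ℕ.≤_) K≡ (palette-mono {R} {level e} (K-size (ℤ.+ R)) (K-size (ℤ.+ level e)) (ℕP.m≤m⊔n R _))
        at-level : ∀ m → K (ℤ.+ level e) ≡ m → ι (suc c) * rate false (level e) ≤ mass (law e) (suc col)
        at-level zero K≡ = contradiction (ℕP.≤-trans col<K (K≤ K≡)) λ ()
        at-level (suc k) K≡ = ≤-trans
          (frac-bound (suc c) (2 ℕ.^ level e) (suc (6 ℕ.* c) ℕ.* suc k) {{ℕP.m^n≢0 2 (level e)}}
            (palette-weight {level e} (subst (PaletteSize r (ℤ.+ level e)) K≡ (K-size (ℤ.+ level e)))))
          (alg1-mass r K (q e) {level e} K≡ (ℕP.≤-trans col<K (K≤ K≡)) ℓ≤ lev≤)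

    -- After `c + 1` halvings a deficit of at most `2 ^ c` has expectation at most 1/2, and a set
    -- that is not a base has deficit at least 1, so Markov's inequality applies.
    base-likely : ∀ {col} → col ℕ.< K (ℤ.+ R) → 1ℚ ≤ ι 2 * expect law (λ C → ι (bit (isBase f (colorClass C (suc col)))))
    base-likely {col} col<K = subst (λ x → 1ℚ ≤ ι 2 * x) (sym (expect-colorClass law (λ e → alg1-total r K (q e)) (suc col) (λ A → ι (bit (isBase f A)))))
      (≤-trans (slack (1ℚ - x * ι 2) (≤⇒0≤- 2x≤1) (solve 1 (λ x → con 1ℚ :+ (con 1ℚ :- x :* con (ι 2)) := con (ι 2) :* (con 1ℚ :- x)) refl x))
        (*-monoˡ (ι 2) (ι-nonneg 2) (subst (_≤ E p (λ A → ι (bit (isBase f A)))) (E-minus p 1ℚ deficit) (E-mono prob markov))))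
      where
      p : Fin n → ℚ
      p e = mass (law e) (suc col)
      prob : Probability p
      prob e = average-nonneg (alg1-nonneg r K (q e)) (λ c → indicator-nonneg (c ≡ᵇ suc col)) ,
               subst (p e ≤_) (alg1-total r K (q e)) (mass≤total (suc col) (alg1-nonneg r K (q e)))
      deficit : Subset n → ℚ
      deficit A = ι r - h A
      x : ℚ
      x = E p deficit
      -- Integrality of `f` enters here: a nonzero deficit is at least 1.
      markov : ∀ A → 1ℚ - deficit A ≤ ι (bit (isBase f A))
      markov A = go (f A ℕ.≟ r)
        where
        go : (d : Dec (f A ≡ r)) → 1ℚ - deficit A ≤ ι (bit (does d))
        go (yes fA≡r) = ≤-reflexive (trans (cong (λ a → 1ℚ - (ι r - ι a)) fA≡r) (solve 1 (λ r → con 1ℚ :- (r :- r) := con 1ℚ) refl (ι r)))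
        go (no fA≢r) = slack (ι r - (1ℚ + h A)) (≤⇒0≤- (subst (_≤ ι r) (ι-+ 1 (f A)) (ι-mono {suc (f A)} {r} (ℕP.≤∧≢⇒< (f≤rank A) fA≢r))))
          (solve 2 (λ r a → con 1ℚ :- (r :- a) :+ (r :- (con 1ℚ :+ a)) := con 0ℚ) refl (ι r) (h A))
      z : Fin n → ℚ
      z = scaled (suc c) w
      z-prob : Probability z
      z-prob e = *-nonneg (ι-nonneg (suc c)) (0≤w e) , ≤-trans (rate≤mass col<K e) (proj₂ (prob e))
      -- The true class probabilities dominate those of the rounds, and the deficit shrinks as the
      -- set grows.
      x≤ : x ≤ E z deficit
      x≤ = E-antitone z-prob prob (rate≤mass col<K) {deficit} (λ {A} {A'} A⊆A' → +-monoʳ-≤ (ι r) (neg-antimono-≤ (ι-mono {f A} {f A'} (monotone A A' A⊆A'))))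
      2x≤1 : x * ι 2 ≤ 1ℚ
      2x≤1 = *-cancelʳ (ι (2 ℕ.^ c)) (2^-pos c) (begin
        x * ι 2 * ι (2 ℕ.^ c)          ≡⟨ solve 3 (λ x a b → x :* a :* b := a :* b :* x) refl x (ι 2) (ι (2 ℕ.^ c)) ⟩
        ι 2 * ι (2 ℕ.^ c) * x          ≡⟨ cong (_* x) (ι-* 2 (2 ℕ.^ c)) ⟨
        ι (2 ℕ.^ suc c) * x            ≤⟨ *-monoˡ (ι (2 ℕ.^ suc c)) (ι-nonneg (2 ℕ.^ suc c)) x≤ ⟩
        ι (2 ℕ.^ suc c) * E z deficit  ≤⟨ deficit-decay (ι r) 0≤w h-increasing h-submodular (λ A → ι-nonneg (f A)) h-progress (suc c) (proj₂ ∘ z-prob) ⟩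
        ι r                            ≤⟨ ι-mono {r} {2 ℕ.^ c} r≤2^c ⟩
        ι (2 ℕ.^ c)                    ≡⟨ *-identityˡ (ι (2 ℕ.^ c)) ⟨
        1ℚ * ι (2 ℕ.^ c)               ∎)
        where open ≤-Reasoning

-- From class probabilities to the competitive ratio.

module Competitiveness where
  open MultilinearExtension
  open Quotients using (module Polymatroid; ∈-tabulate⁺; sum-mono; sum-const)
  open Palettes
  open ColorLaws
  open ClassProbabilities
  open import Data.Nat as ℕ using (ℕ; zero; suc; _<_; s≤s; z≤n)
  import Data.Nat.Properties as ℕP
  open import Data.Nat.Logarithm using (⌈log₂_⌉)
  open import Data.Nat.Solver renaming (module +-*-Solver to ℕ-Solver)
  open import Data.Integer as ℤ using (ℤ)
  open import Data.Rational as ℚ using (ℚ; 0ℚ; 1ℚ; _/_; _+_; _*_; _-_)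
  import Data.Rational.Properties as ℚP
  open import Data.Rational.Solver using (module +-*-Solver)
  open import Data.Bool using (true)
  open import Data.Fin using (Fin; zero; suc; toℕ; fromℕ<)
  open import Data.Fin.Properties using (toℕ-fromℕ<)
  open import Data.Fin.Subset using (Subset; ⁅_⁆; ⊤; ⊥; _∈_)
  open import Data.Fin.Subset.Properties using (⊆⊤; x∈⁅y⁆⇒x≡y)
  open import Data.Vec using (_∷_)
  open import Data.Product using (∃; _×_; _,_)
  open import Data.Sum using (inj₂)
  open import Relation.Nullary using (¬_; Dec; contradiction; yes; no)
  open import Relation.Nullary.Decidable using (dec-true)
  open import Relation.Binary.PropositionalEquality using (_≡_; refl; sym; trans; cong; subst; subst₂)

  dyadic : ∀ o → 0 < o → ∃ λ k → 2 ℕ.^ k ℕ.≤ o × o < 2 ℕ.^ suc k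
  dyadic (suc zero) _ = 0 , s≤s z≤n , s≤s (s≤s z≤n)
  dyadic (suc (suc o)) _ with dyadic (suc o) (s≤s z≤n)
  ... | k , low , high with suc (suc o) ℕ.<? 2 ℕ.^ suc k
  ... | yes lt = k , ℕP.m≤n⇒m≤1+n low , lt
  ... | no ¬lt = suc k , ℕP.≮⇒≥ ¬lt , ℕP.≤-<-trans high (ℕP.^-monoʳ-< 2 (s≤s (s≤s z≤n)) (ℕP.n<1+n (suc k)))

  -- The dyadic exponent of `o` is lowered by one, which is possible as `o ≥ 2`; the factor 2 gained
  -- covers the small elements in `progress`.
  scale : ∀ o → 2 ℕ.≤ o → ∃ λ R → 2 ℕ.* 2 ℕ.^ R ℕ.≤ o × o < 2 ℕ.* (2 ℕ.* 2 ℕ.^ R)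
  scale o 2≤o with dyadic o (ℕP.≤-trans (s≤s z≤n) 2≤o)
  ... | zero , _ , o<2 = contradiction 2≤o (ℕP.<⇒≱ o<2)
  ... | suc R , low , high = R , low , high

  -- The three strategies and their mixture.

  module Mixture {n} (f : Subset n → ℕ) (P : IsPolymatroid f) (pos : 0 < f ⊤)
           (law : Fin n → Dist) (nonneg : ∀ i → NonnegWeights (law i)) where
    open IsPolymatroid P

    ⊥-not-base : ¬ f ⊥ ≡ f ⊤
    ⊥-not-base eq = ℕP.<⇒≢ pos (trans (sym normalized) eq)

    random single arrival mixture : ℚ
    random = expect law (λ C → ℕtoℚ (numBaseColors f C))
    single = ℕtoℚ (numBaseColors f (λ _ → 1))
    arrival = ℕtoℚ (numBaseColors f (λ i → suc (toℕ i)))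
    mixture = (ℤ.+ 1 / 3) * random + (ℤ.+ 1 / 3) * single + (ℤ.+ 1 / 3) * arrival

    3mixture : ι 3 * mixture ≡ random + single + arrival
    3mixture = solve 3 (λ a b d → con (ι 3) :* (con (ℤ.+ 1 / 3) :* a :+ con (ℤ.+ 1 / 3) :* b :+ con (ℤ.+ 1 / 3) :* d) := a :+ b :+ d) refl random single arrival
      where open +-*-Solver

    0≤random : 0ℚ ℚ.≤ random
    0≤random = expect-nonneg law nonneg (λ C → ι-nonneg (numBaseColors f C))

    0≤single : 0ℚ ℚ.≤ single
    0≤single = ι-nonneg (numBaseColors f (λ _ → 1))

    0≤arrival : 0ℚ ℚ.≤ arrival
    0≤arrival = ι-nonneg (numBaseColors f (λ i → suc (toℕ i)))

    random≤ : random ℚ.≤ ι 3 * mixture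
    random≤ = slack (single + arrival) (+-nonneg 0≤single 0≤arrival) (trans (sym (ℚP.+-assoc random single arrival)) (sym 3mixture))

    arrival≤ : arrival ℚ.≤ ι 3 * mixture
    arrival≤ = slack (random + single) (+-nonneg 0≤random 0≤single) (trans (ℚP.+-comm arrival (random + single)) (sym 3mixture))

    1≤single : 1ℚ ℚ.≤ single
    1≤single = ι-mono {1} {numBaseColors f (λ _ → 1)} (ℕP.≤-trans
      (all-baseColors f (λ _ → 1) 1 λ { zero _ → cong f full ; (suc _) (s≤s ()) })
      (baseColors≤numBaseColors f (λ _ → 1) ⊥-not-base 1))
      where
      full : ∀ {n} → colorClass {n} (λ _ → 1) 1 ≡ ⊤
      full {zero} = refl
      full {suc n} = cong (true ∷_) full

    -- In rank at most 1 every singleton is already a base, so each arrival color counts.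
    n≤arrival : f ⊤ ℕ.≤ 1 → (∀ e → 0 < f ⁅ e ⁆) → ι n ℚ.≤ arrival
    n≤arrival r≤1 singleton-pos = ι-mono {n} {numBaseColors f C} (ℕP.≤-trans
      (all-baseColors f C n λ col col<n → ℕP.≤-antisym (monotone _ _ ⊆⊤) (ℕP.≤-trans r≤1
        (ℕP.≤-trans (singleton-pos (fromℕ< col<n)) (monotone _ _ (own col col<n)))))
      (baseColors≤numBaseColors f C ⊥-not-base n))
      where
      C : Coloring n
      C i = suc (toℕ i)
      own : ∀ col (col<n : col < n) {x} → x ∈ ⁅ fromℕ< col<n ⁆ → x ∈ colorClass C (suc col)
      own col col<n x∈ with x∈⁅y⁆⇒x≡y _ x∈
      ... | refl = ∈-tabulate⁺ {b = λ i → toℕ i ℕ.≡ᵇ col} (dec-true (toℕ (fromℕ< col<n) ℕ.≟ col) (toℕ-fromℕ< col<n))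

    random-lower : ∀ k → (∀ col → col < k → 1ℚ ℚ.≤ ι 2 * expect law (λ C → ι (bit (isBase f (colorClass C (suc col)))))) →
                   ι k ℚ.≤ ι 2 * random
    random-lower k likely = ℚP.≤-trans (expect-baseColors f law nonneg (ι 2) k likely)
      (*-monoˡ (ι 2) (ι-nonneg 2) (expect-mono law nonneg
        (λ C → ι-mono {baseColorsUpTo f C k} {numBaseColors f C} (baseColors≤numBaseColors f C ⊥-not-base k))))

    -- The constant coloring, chosen with probability 1/3, always yields a base. The constant is 6
    -- to match `2random≤`.
    1≤6mixture : ι 1 ℚ.≤ ι 6 * mixture
    1≤6mixture = slack ((single - 1ℚ) + (random + arrival) + (random + single + arrival))
      (+-nonneg (+-nonneg (≤⇒0≤- 1≤single) (+-nonneg 0≤random 0≤arrival)) (+-nonneg (+-nonneg 0≤random 0≤single) 0≤arrival))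
      (trans (solve 3 (λ a b d → con 1ℚ :+ ((b :- con 1ℚ) :+ (a :+ d) :+ (a :+ b :+ d)) := con (ι 2) :* (a :+ b :+ d)) refl random single arrival)
        (trans (cong (ι 2 *_) (sym 3mixture)) (solve 1 (λ m → con (ι 2) :* (con (ι 3) :* m) := con (ι 6) :* m) refl mixture)))
      where open +-*-Solver

    2random≤ : ι 2 * random ℚ.≤ ι 6 * mixture
    2random≤ = ℚP.≤-trans (*-monoˡ (ι 2) (ι-nonneg 2) random≤)
      (ℚP.≤-reflexive (solve 1 (λ m → con (ι 2) :* (con (ι 3) :* m) := con (ι 6) :* m) refl mixture))
      where open +-*-Solver

  -- `κ` is a number of base colors guaranteed up to the factor 6. For every rational `x` above
  -- `log₂ r`, `c ≤ 2x` costs a factor 4, and `480 * 6 * 4` is `11520`.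
  ratioBound : ∀ {r} (2≤r : 2 ℕ.≤ r) {o κ E'} → o ℕ.≤ 480 ℕ.* κ ℕ.* (⌈log₂ r ⌉ ℕ.* ⌈log₂ r ⌉) → ι κ ℚ.≤ ι 6 * E' →
               RatioBound 11520 r o E'
  ratioBound {r} 2≤r {o} {κ} {E'} o≤ κ≤ = inj₂ λ (a , b , r^≤ , lt) → ℚP.<-irrefl refl (ℚP.<-≤-trans lt (bound a b r^≤))
    where
    open ℚP.≤-Reasoning
    open +-*-Solver
    c = ⌈log₂ r ⌉
    bound : ∀ a b → r ℕ.^ suc b ℕ.≤ 2 ℕ.^ a → ι o ℚ.≤ ι 11520 * E' * ((ℤ.+ a / suc b) * (ℤ.+ a / suc b))
    bound a b r^≤ = begin
      ι o                                        ≤⟨ ι-mono {o} {480 ℕ.* κ ℕ.* (c ℕ.* c)} o≤ ⟩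
      ι (480 ℕ.* κ ℕ.* (c ℕ.* c))                ≡⟨ ι-* (480 ℕ.* κ) (c ℕ.* c) ⟩
      ι (480 ℕ.* κ) * ι (c ℕ.* c)                ≡⟨ cong (λ t → t * ι (c ℕ.* c)) (ι-* 480 κ) ⟩
      ι 480 * ι κ * ι (c ℕ.* c)                  ≡⟨ cong (λ t → ι 480 * ι κ * t) (ι-* c c) ⟩
      ι 480 * ι κ * (ι c * ι c)                  ≤⟨ *-monoʳ (ι c * ι c) (*-nonneg (ι-nonneg c) (ι-nonneg c)) (*-monoˡ (ι 480) (ι-nonneg 480) κ≤) ⟩
      ι 480 * (ι 6 * E') * (ι c * ι c)           ≤⟨ *-monoˡ (ι 480 * (ι 6 * E')) 0≤E c²≤ ⟩
      ι 480 * (ι 6 * E') * (ι 2 * x * (ι 2 * x)) ≡⟨ solve 2 (λ e x → con (ι 480) :* (con (ι 6) :* e) :* (con (ι 2) :* x :* (con (ι 2) :* x)) := con (ι 11520) :* e :* (x :* x)) refl E' x ⟩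
      ι 11520 * E' * (x * x)                     ∎
      where
      x = ℤ.+ a / suc b
      0≤E : 0ℚ ℚ.≤ ι 480 * (ι 6 * E')
      0≤E = *-nonneg (ι-nonneg 480) (ℚP.≤-trans (ι-nonneg κ) κ≤)
      c≤ : ι c ℚ.≤ ι 2 * x
      c≤ = *-cancelʳ (ι (suc b)) (ι-pos b) (begin
        ι c * ι (suc b)            ≡⟨ ι-* c (suc b) ⟨
        ι (c ℕ.* suc b)            ≤⟨ ι-mono {c ℕ.* suc b} {2 ℕ.* a} (Palette.c-upper 2≤r {a} {suc b} r^≤) ⟩
        ι (2 ℕ.* a)                ≡⟨ ι-* 2 a ⟩
        ι 2 * ι a                  ≡⟨ cong (λ t → ι 2 * t) (frac-cancel a (suc b)) ⟨
        ι 2 * (x * ι (suc b))      ≡⟨ ℚP.*-assoc (ι 2) x (ι (suc b)) ⟨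
        ι 2 * x * ι (suc b)        ∎)
      c²≤ : ι c * ι c ℚ.≤ ι 2 * x * (ι 2 * x)
      c²≤ = ℚP.≤-trans (*-monoˡ (ι c) (ι-nonneg c) c≤) (*-monoʳ (ι 2 * x) (*-nonneg (ι-nonneg 2) (frac-nonneg a (suc b))) c≤)

  module _ {n} {f : Subset n → ℕ} (P : IsPolymatroid f)
           {q : Fin n → ℕ} (q-min : ∀ i → IsMinQuotientSize f i (q i))
           {K : ℤ → ℕ} (K-size : ∀ R → PaletteSize (f ⊤) R (K R))
           {o} (B : Fin o → Subset n) (disjoint : PairwiseDisjoint B) (base : ∀ i → IsBase f (B i)) where
    open Polymatroid P
    open IsPolymatroid P

    law : Fin n → Dist
    law i = alg1Law (f ⊤) K (q i)

    law-nonneg : ∀ i → NonnegWeights (law i)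
    law-nonneg i = alg1-nonneg (f ⊤) K (q i)

    -- At the empty set the deficit is 1 and each marginal is at most 1, so `bases-bound` gives
    -- `o ≤ n`, and the arrival coloring has `n` base colors.
    rank-one : f ⊤ ≡ 1 → (∀ e → 0 < f ⁅ e ⁆) → ι o ℚ.≤ ι 11520 * expectedAlgStar f q K
    rank-one r≡1 singleton-pos = ℚP.≤-trans
        (ι-mono {o} {n} (subst₂ ℕ._≤_ (trans (cong (o ℕ.*_) deficit≡1) (ℕP.*-identityʳ o)) (trans (cong (n ℕ.*_) deficit≡1) (ℕP.*-identityʳ n)) o≤n))
        -- The excess factor 3839 raises 3 to the common constant: `3 * (1 + 3839)` is `11520`.
        (ℚP.≤-trans n≤3E (slack (ι 3839 * (ι 3 * E')) (*-nonneg (ι-nonneg 3839) (ℚP.≤-trans (ι-nonneg n) n≤3E))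
          (solve 1 (λ e → con (ι 3) :* e :+ con (ι 3839) :* (con (ι 3) :* e) := con (ι 11520) :* e) refl E')))
      where
      open +-*-Solver
      E' = expectedAlgStar f q K
      open Mixture f P (subst (0 <_) (sym r≡1) (s≤s z≤n)) law law-nonneg
      n≤3E : ι n ℚ.≤ ι 3 * E'
      n≤3E = ℚP.≤-trans (n≤arrival (ℕP.≤-reflexive r≡1) singleton-pos) (arrival≤)
      deficit≡1 : f ⊤ ℕ.∸ f ⊥ ≡ 1
      deficit≡1 = trans (cong (f ⊤ ℕ.∸_) normalized) r≡1
      o≤n : o ℕ.* (f ⊤ ℕ.∸ f ⊥) ℕ.≤ n ℕ.* (f ⊤ ℕ.∸ f ⊥)
      o≤n = ℕP.≤-trans (bases-bound B disjoint base ⊥)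
        (ℕP.≤-trans (sum-mono (λ e → marginal≤deficit e ⊥)) (ℕP.≤-reflexive (sum-const n _)))

    few-bases : 2 ℕ.≤ f ⊤ → ¬ 2 ℕ.≤ o → RatioBound 11520 (f ⊤) o (expectedAlgStar f q K)
    few-bases 2≤r 2≰o = ratioBound 2≤r {o} {1} {expectedAlgStar f q K} o≤ (1≤6mixture)
      where
      open Palette 2≤r
      open Mixture f P (ℕP.≤-trans (s≤s z≤n) 2≤r) law law-nonneg
      o≤ : o ℕ.≤ 480 ℕ.* 1 ℕ.* (c ℕ.* c)
      o≤ = ℕP.≤-trans (ℕP.≤-pred (ℕP.≰⇒> 2≰o)) (ℕP.*-mono-≤ {1} {480} {1} {c ℕ.* c} (s≤s z≤n) (ℕP.*-mono-≤ 1≤c 1≤c))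

    many-bases : 2 ℕ.≤ f ⊤ → ∀ {R} → 2 ℕ.* 2 ℕ.^ R ℕ.≤ o → o < 2 ℕ.* (2 ℕ.* 2 ℕ.^ R) →
                 RatioBound 11520 (f ⊤) o (expectedAlgStar f q K)
    many-bases 2≤r {R} low high = by-palette (K (ℤ.+ R)) refl
      where
      open Palette 2≤r
      open Mixture f P (ℕP.≤-trans (s≤s z≤n) 2≤r) law law-nonneg
      -- The hypothesis on `κ` covers an empty palette with `κ = 1` and a nonempty one with `κ` its
      -- size. The constant 480 is 4 from the choice of `R`, 60 from the palette and 2 from the
      -- hypothesis.
      o≤ : ∀ κ → suc (K (ℤ.+ R)) ℕ.≤ 2 ℕ.* κ → o ℕ.≤ 480 ℕ.* κ ℕ.* (c ℕ.* c)
      o≤ κ K<2κ = begin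
        o                                                  ≤⟨ ℕP.<⇒≤ high ⟩
        2 ℕ.* (2 ℕ.* 2 ℕ.^ R)                              ≤⟨ ℕP.*-monoʳ-≤ 2 (ℕP.*-monoʳ-≤ 2 (ℕP.<⇒≤ (palette-lower {R} (K-size (ℤ.+ R))))) ⟩
        2 ℕ.* (2 ℕ.* (60 ℕ.* suc (K (ℤ.+ R)) ℕ.* (c ℕ.* c)))
          ≤⟨ ℕP.*-monoʳ-≤ 2 (ℕP.*-monoʳ-≤ 2 (ℕP.*-monoˡ-≤ (c ℕ.* c) (ℕP.*-monoʳ-≤ 60 K<2κ))) ⟩
        2 ℕ.* (2 ℕ.* (60 ℕ.* (2 ℕ.* κ) ℕ.* (c ℕ.* c)))     ≡⟨ solve 2 (λ k x → con 2 :* (con 2 :* (con 60 :* (con 2 :* k) :* x)) := con 480 :* k :* x) refl κ (c ℕ.* c) ⟩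
        480 ℕ.* κ ℕ.* (c ℕ.* c)                            ∎
        where
        open ℕP.≤-Reasoning
        open ℕ-Solver
      by-palette : ∀ m → K (ℤ.+ R) ≡ m → RatioBound 11520 (f ⊤) o (expectedAlgStar f q K)
      -- With an empty palette at `R`, `o` is at most `480c²`, and the single base of the constant
      -- coloring suffices.
      by-palette zero K≡ = ratioBound 2≤r {o} {1} {expectedAlgStar f q K} (o≤ 1 (subst (λ m → suc m ℕ.≤ 2) (sym K≡) (s≤s z≤n))) (1≤6mixture)
      by-palette (suc k) K≡ = ratioBound 2≤r {o} {suc k} {expectedAlgStar f q K}
        (o≤ (suc k) (subst (λ m → suc m ℕ.≤ 2 ℕ.* suc k) (sym K≡) (s≤s (ℕP.≤-trans (ℕP.m≤m+n (suc k) k) (ℕP.≤-reflexive (trans (cong suc (cong (k ℕ.+_) (sym (ℕP.+-identityʳ k)))) (sym (ℕP.+-suc k (k ℕ.+ 0)))))))))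
        (ℚP.≤-trans (random-lower (suc k)
            (λ col col<k → BaseProbability.base-likely P 2≤r q-min K-size B disjoint base {R = R} low (subst (col <_) (sym K≡) col<k)))
          2random≤)

    high-rank : 2 ℕ.≤ f ⊤ → RatioBound 11520 (f ⊤) o (expectedAlgStar f q K)
    high-rank 2≤r = by-bases (2 ℕ.≤? o)
      where
      by-bases : Dec (2 ℕ.≤ o) → RatioBound 11520 (f ⊤) o (expectedAlgStar f q K)
      by-bases (no 2≰o) = few-bases 2≤r 2≰o
      by-bases (yes 2≤o) = let R , low , high = scale o 2≤o in many-bases 2≤r {R} low high

-- Case distinction on the rank.

open import Data.Nat using (ℕ; _<_)
open import Data.Integer using (ℤ)
open import Data.Fin using (Fin)
open import Data.Fin.Subset using (Subset; ⁅_⁆; ⊤)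
open import Data.Product using (Σ)
import Data.Nat as ℕ
import Data.Nat.Properties as ℕP
open import Data.Fin.Subset using (⊥)
open import Data.Fin.Subset.Properties using (∩-idem)
open import Data.Product using (_,_)
open import Data.Sum using (inj₁)
open import Relation.Nullary using (¬_; Dec; yes; no)
open import Relation.Binary.PropositionalEquality using (_≡_; sym; trans)
open Competitiveness

theorem3p8 : Σ ℕ λ C0 →
    ∀ (n : ℕ) (f : Subset n → ℕ) → IsPolymatroid f → (∀ e → 0 < f ⁅ e ⁆) →
    (q : Fin n → ℕ) → (∀ i → IsMinQuotientSize f i (q i)) →
    (K : ℤ → ℕ) → (∀ R → PaletteSize (f ⊤) R (K R)) →
    (o : ℕ) → IsOpt f o →
    RatioBound C0 (f ⊤) o (expectedAlgStar f q K)
theorem3p8 = 11520 , λ n f P singleton-pos q q-min K K-size o ((B , disjoint , base) , maximal) → let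
    -- In rank 0 the empty set is a base disjoint from itself, so `suc o` copies of it would
    -- contradict the maximality of `o`.
    rank≢0 : ¬ f ⊤ ≡ 0
    rank≢0 r≡0 = ℕP.<⇒≱ ℕP.≤-refl
      (maximal (ℕ.suc o) (λ _ → ⊥) (λ _ _ _ → ∩-idem ⊥) (λ _ → trans (IsPolymatroid.normalized P) (sym r≡0)))

    by-rank : Dec (2 ℕ.≤ f ⊤) → RatioBound 11520 (f ⊤) o (expectedAlgStar f q K)
    by-rank = λ where
      (yes 2≤r) → high-rank P q-min K-size B disjoint base 2≤r
      (no 2≰r) → inj₁ (rank-one P q-min K-size B disjoint base
        (ℕP.≤-antisym (ℕP.≤-pred (ℕP.≰⇒> 2≰r)) (ℕP.n≢0⇒n>0 rank≢0)) singleton-pos)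
  in by-rank (2 ℕ.≤? f ⊤)
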